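{- Let $\mathsf X$ be a 45-closed subset of $\{\mathsf d,\mathsf t,\mathsf b,\mathsf 4,\mathsf 5\}$. For every nested sequent $\Gamma$: if $\mathsf K+\Diamond\mathsf X_{\mathsf c}+\mathsf{cut}\vdash\Gamma$ then $\mathsf K+\Diamond\mathsf X_{\mathsf c}\vdash\Gamma$.
   Context: Formulas: $A::=p\mid\bar p\mid A\vee A\mid A\wedge A\mid\Diamond A\mid\Box A$, $\bar A$ by De Morgan laws. A nested sequent is a finite multiset of formulas and boxed sequents $[\Delta]$. Contexts $\Gamma\{\ \}$ (one hole, not inside formulas), filling $\Gamma\{\Delta\}$, binary contexts $\Gamma\{\ \}\{\ \}$, depth of $\Gamma\{\ \}\{\emptyset\}$ = number of boxes enclosing the first hole. Rules (premises / conclusion): axiom $\Gamma\{p,\bar p\}$; $\wedge$: $\Gamma\{A\},\Gamma\{B\}/\Gamma\{A\wedge B\}$; $\vee$: $\Gamma\{A,B\}/\Gamma\{A\vee B\}$; $\Box$: $\Gamma\{[A]\}/\Gamma\{\Box A\}$; $\Diamond\mathsf k_{\mathsf c}$: $\Gamma\{\Diamond A,[\Delta,A]\}/\Gamma\{\Diamond A,[\Delta]\}$; $\Diamond\mathsf d_{\mathsf c}$: $\Gamma\{\Diamond A,[A]\}/\Gamma\{\Diamond A\}$; $\Diamond\mathsf t_{\mathsf c}$: $\Gamma\{\Diamond A,A\}/\Gamma\{\Diamond A\}$; $\Diamond\mathsf b_{\mathsf c}$: $\Gamma\{[\Delta,\Diamond A],A\}/\Gamma\{[\Delta,\Diamond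 A]\}$; $\Diamond\mathsf 4_{\mathsf c}$: $\Gamma\{\Diamond A,[\Delta,\Diamond A]\}/\Gamma\{\Diamond A,[\Delta]\}$; $\Diamond\mathsf 5_{\mathsf c}$: $\Gamma\{\Diamond A\}\{\Diamond A\}/\Gamma\{\Diamond A\}\{\emptyset\}$ if depth of $\Gamma\{\ \}\{\emptyset\}>0$; $\mathsf{cut}$: $\Gamma\{A\},\Gamma\{\bar A\}/\Gamma\{\emptyset\}$. $\mathsf K=\{\wedge,\vee,\Box,\Diamond\mathsf k_{\mathsf c}\}$ with the axiom; $\mathsf K+\Diamond\mathsf X_{\mathsf c}$ adds $\Diamond\rho_{\mathsf c}$ for $\rho\in\mathsf X$. $\vdash$ denotes provability by finite trees whose leaves are axioms. $\mathsf X$ is 45-closed if for each $\rho\in\{\mathsf 4,\mathsf 5\}$: if every Kripke frame satisfying the frame conditions of $\mathsf X$ ($\mathsf d$ serial, $\mathsf t$ reflexive, $\mathsf b$ symmetric, $\mathsf 4$ transitive, $\mathsf 5$ euclidean) also satisfies the condition of $\rho$, then $\rho\in\mathsf X$. -}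

module Defs where

open import Data.Nat using (ℕ; zero; suc; _<_)
open import Data.Bool using (Bool; true; false)
open import Data.List using (List; []; _∷_; _++_)
open import Data.Product using (∃)
open import Relation.Binary.PropositionalEquality using (_≡_)

data Fm : Set where
  atom  : ℕ → Fm
  natom : ℕ → Fm
  _∨'_  : Fm → Fm → Fm
  _∧'_  : Fm → Fm → Fm
  ◇_    : Fm → Fm
  □_    : Fm → Fm

neg : Fm → Fm
neg (atom p)  = natom p
neg (natom p) = atom p
neg (A ∨' B)  = neg A ∧' neg B
neg (A ∧' B)  = neg A ∨' neg B
neg (◇ A)     = □ neg A
neg (□ A)     = ◇ neg A

-- Nested sequents: finite multisets (lists up to ≋ below) of formulas
-- and boxed sequents [Δ].

data Item : Set where
  fml : Fm → Item
  bx  : List Item → Item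

Seq : Set
Seq = List Item

mutual
  data _≈ᵢ_ : Item → Item → Set where
    fml-refl : ∀ {A} → fml A ≈ᵢ fml A
    bx-cong  : ∀ {Γ Δ} → Γ ≋ Δ → bx Γ ≈ᵢ bx Δ

  data _≋_ : Seq → Seq → Set where
    []    : [] ≋ []
    cons  : ∀ {I J Γ Δ} → I ≈ᵢ J → Γ ≋ Δ → (I ∷ Γ) ≋ (J ∷ Δ)
    swap  : ∀ {I J Γ} → (I ∷ J ∷ Γ) ≋ (J ∷ I ∷ Γ)
    trans : ∀ {Γ Δ Σ} → Γ ≋ Δ → Δ ≋ Σ → Γ ≋ Σ

-- Unary contexts Γ{ } (up to multiset reordering)

data Ctx : Set where
  hole : Seq → Ctx
  inbx : Seq → Ctx → Ctx

_⟨_⟩ : Ctx → Seq → Seq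
hole Γ   ⟨ Δ ⟩ = Δ ++ Γ
inbx Γ C ⟨ Δ ⟩ = bx (C ⟨ Δ ⟩) ∷ Γ

depth : Ctx → ℕ
depth (hole _)   = 0
depth (inbx _ C) = suc (depth C)

-- Binary contexts Γ{ }{ } (up to multiset reordering)

data Ctx2 : Set where
  here-here   : Seq → Ctx2
  here-there  : Seq → Ctx → Ctx2
  there-here  : Seq → Ctx → Ctx2
  there-there : Seq → Ctx → Ctx → Ctx2
  inbx2       : Seq → Ctx2 → Ctx2

_⟨_⟩⟨_⟩ : Ctx2 → Seq → Seq → Seq
here-here Γ         ⟨ Δ₁ ⟩⟨ Δ₂ ⟩ = Δ₁ ++ Δ₂ ++ Γ
here-there Γ C      ⟨ Δ₁ ⟩⟨ Δ₂ ⟩ = Δ₁ ++ bx (C ⟨ Δ₂ ⟩) ∷ Γ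
there-here Γ C      ⟨ Δ₁ ⟩⟨ Δ₂ ⟩ = bx (C ⟨ Δ₁ ⟩) ∷ Δ₂ ++ Γ
there-there Γ C C'  ⟨ Δ₁ ⟩⟨ Δ₂ ⟩ = bx (C ⟨ Δ₁ ⟩) ∷ bx (C' ⟨ Δ₂ ⟩) ∷ Γ
inbx2 Γ C           ⟨ Δ₁ ⟩⟨ Δ₂ ⟩ = bx (C ⟨ Δ₁ ⟩⟨ Δ₂ ⟩) ∷ Γ

depth2 : Ctx2 → ℕ
depth2 (here-here _)       = 0
depth2 (here-there _ _)    = 0
depth2 (there-here _ C)    = suc (depth C)
depth2 (there-there _ C _) = suc (depth C)
depth2 (inbx2 _ C)         = suc (depth2 C)

data Ax : Set where
  d t b four five : Ax

AxSet : Set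
AxSet = Ax → Bool

_∈X_ : Ax → AxSet → Set
ρ ∈X X = X ρ ≡ true

FrameCond : Ax → (W : Set) → (W → W → Set) → Set
FrameCond d    W R = ∀ w → ∃ λ v → R w v
FrameCond t    W R = ∀ w → R w w
FrameCond b    W R = ∀ w v → R w v → R v w
FrameCond four W R = ∀ w v u → R w v → R v u → R w u
FrameCond five W R = ∀ w v u → R w v → R w u → R v u

SatisfiesX : AxSet → (W : Set) → (W → W → Set) → Set
SatisfiesX X W R = ∀ ρ → ρ ∈X X → FrameCond ρ W R

FrameEntails : AxSet → Ax → Set₁
FrameEntails X ρ = (W : Set) (R : W → W → Set) → SatisfiesX X W R → FrameCond ρ W R

45-closed : AxSet → Set₁
45-closed X = (FrameEntails X four → four ∈X X) Data.Product.× (FrameEntails X five → five ∈X X)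

-- Provability in K + ◇X_c (+ cut if the flag is true).
-- Multisets are modelled by lists together with the exchange rule `exch`.

[_] : Item → Seq
[ I ] = I ∷ []

infix 1 ⊢[_,_]_

data ⊢[_,_]_ (X : AxSet) (cut : Bool) : Seq → Set where
  ax   : ∀ C p → ⊢[ X , cut ] C ⟨ fml (atom p) ∷ fml (natom p) ∷ [] ⟩
  ∧r   : ∀ C A B → ⊢[ X , cut ] C ⟨ [ fml A ] ⟩ → ⊢[ X , cut ] C ⟨ [ fml B ] ⟩
       → ⊢[ X , cut ] C ⟨ [ fml (A ∧' B) ] ⟩
  ∨r   : ∀ C A B → ⊢[ X , cut ] C ⟨ fml A ∷ fml B ∷ [] ⟩ → ⊢[ X , cut ] C ⟨ [ fml (A ∨' B) ] ⟩
  □r   : ∀ C A → ⊢[ X , cut ] C ⟨ [ bx [ fml A ] ] ⟩ → ⊢[ X , cut ] C ⟨ [ fml (□ A) ] ⟩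
  ◇k   : ∀ C A Δ → ⊢[ X , cut ] C ⟨ fml (◇ A) ∷ bx (fml A ∷ Δ) ∷ [] ⟩
       → ⊢[ X , cut ] C ⟨ fml (◇ A) ∷ bx Δ ∷ [] ⟩
  ◇d   : d ∈X X → ∀ C A → ⊢[ X , cut ] C ⟨ fml (◇ A) ∷ bx [ fml A ] ∷ [] ⟩
       → ⊢[ X , cut ] C ⟨ [ fml (◇ A) ] ⟩
  ◇t   : t ∈X X → ∀ C A → ⊢[ X , cut ] C ⟨ fml (◇ A) ∷ fml A ∷ [] ⟩
       → ⊢[ X , cut ] C ⟨ [ fml (◇ A) ] ⟩
  ◇b   : b ∈X X → ∀ C A Δ → ⊢[ X , cut ] C ⟨ bx (fml (◇ A) ∷ Δ) ∷ fml A ∷ [] ⟩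
       → ⊢[ X , cut ] C ⟨ [ bx (fml (◇ A) ∷ Δ) ] ⟩
  ◇4   : four ∈X X → ∀ C A Δ → ⊢[ X , cut ] C ⟨ fml (◇ A) ∷ bx (fml (◇ A) ∷ Δ) ∷ [] ⟩
       → ⊢[ X , cut ] C ⟨ fml (◇ A) ∷ bx Δ ∷ [] ⟩
  ◇5   : five ∈X X → ∀ (C : Ctx2) A → 0 < depth2 C
       → ⊢[ X , cut ] C ⟨ [ fml (◇ A) ] ⟩⟨ [ fml (◇ A) ] ⟩
       → ⊢[ X , cut ] C ⟨ [ fml (◇ A) ] ⟩⟨ [] ⟩
  cutr : cut ≡ true → ∀ C A → ⊢[ X , cut ] C ⟨ [ fml A ] ⟩ → ⊢[ X , cut ] C ⟨ [ fml (neg A) ] ⟩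
       → ⊢[ X , cut ] C ⟨ [] ⟩
  exch : ∀ {Γ Δ} → Γ ≋ Δ → ⊢[ X , cut ] Γ → ⊢[ X , cut ] Δ

{-# OPTIONS --safe #-}
module Submission where

-- The proof is semantic. Derivability in a cumulative labelled version of K + ◇X_c is used
-- as the pole of an orthogonality semantics: a state T is a finite set of edges x → y and
-- labelled formulas x ∶ A, and every formula A gets at each label x two orthogonal sets of
-- states, those forcing A and those refuting A. States containing x ∶ A refute A at x.
-- Labels accessible from x are those at which ◇ A at x can be made to produce A; 45-closure
-- is what makes this relation satisfy the frame conditions of X, so that K + ◇X_c + cut is
-- sound for the semantics. Soundness then yields a cut-free labelled derivation, which
-- is mapped along a homomorphism into a labelled tree and so into nested sequents.

open import Defs
open import Algebra.Bundles using (CommutativeMonoid)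
open import Data.Bool using (true; false)
open import Data.List using (List; []; _∷_; _++_)
open import Data.List.Membership.Propositional using (_∈_)
open import Data.List.Membership.Propositional.Properties using (∈-++⁺ˡ; ∈-++⁺ʳ)
open import Data.List.Properties using (++-assoc; ++-identityʳ)
open import Data.List.Relation.Binary.Permutation.Propositional as Perm using (_↭_)
open import Data.List.Relation.Binary.Permutation.Propositional.Properties using (++-comm)
open import Data.List.Relation.Binary.Subset.Propositional using (_⊆_)
open import Data.List.Relation.Unary.Any using (here; there)
open import Data.Nat using (ℕ; suc; _<_; _≤_; _⊔_; _≟_; z≤n; s≤s)
open import Data.Nat.Properties using (≤-refl; ≤-trans; m≤m⊔n; m≤n⊔m; <⇒≢; >⇒≢)
open import Data.Product using (∃; _×_; _,_; proj₁; proj₂)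
open import Data.Sum using (_⊎_; inj₁; inj₂; [_,_]′)
open import Data.Unit using (⊤; tt)
open import Function using (id; _∘_)
open import Relation.Binary.Construct.Closure.Equivalence using (EqClosure)
import Relation.Binary.Construct.Closure.Equivalence as Eq
open import Relation.Binary.Construct.Closure.ReflexiveTransitive as Star using (Star; ε; _◅_; _◅◅_)
open import Relation.Binary.Construct.Closure.Symmetric using (fwd; bwd)
open import Relation.Binary.PropositionalEquality using (_≡_; _≢_; refl; sym; cong; cong₂; subst; subst₂)
import Relation.Binary.PropositionalEquality as ≡
open import Relation.Nullary using (¬_; Dec; yes; no; contradiction)
open import Relation.Nullary.Decidable using (_⊎-dec_)

-- 45-closure enters as three implications: b with 4 gives 5, b with 5 gives 4, t with 5 gives 4.
-- They are called for when a `◇` has to travel against an edge, or to leave a label that need not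
-- have a predecessor.
--
-- Seriality cannot be treated like the other frame conditions, since a label of a finite state may
-- have no successor. For d, a new leaf is added to the state and afterwards eliminated from the
-- labelled derivation.
--
-- The labelled 5-rule may send a `◇` to any label, but accessibility through 5 stays within a
-- connected component. Otherwise an isolated label could be accessible without being able to reach
-- anything in return, against symmetry and euclideanness.

set : {B : Set} → (ℕ → B) → ℕ → B → ℕ → B
set f z c v with v ≟ z
... | yes _ = c
... | no _  = f v

set-≡ : {B : Set} (f : ℕ → B) (z : ℕ) (c : B) → set f z c z ≡ c
set-≡ f z c with z ≟ z
... | yes _  = refl
... | no z≢z = contradiction refl z≢z

set-≢ : {B : Set} (f : ℕ → B) {z : ℕ} (c : B) {v : ℕ} → z ≢ v → set f z c v ≡ f v
set-≢ f {z} c {v} z≢v with v ≟ z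
... | yes v≡z = contradiction (sym v≡z) z≢v
... | no _    = refl

-- The labelled calculus

infix 6 _∶_
infix 4 _#_

data Entry : Set where
  edge : ℕ → ℕ → Entry
  _∶_  : ℕ → Fm → Entry

State : Set
State = List Entry

_#_ : ℕ → Entry → Set
z # edge x y = z ≢ x × z ≢ y
z # x ∶ A    = z ≢ x

Fresh : ℕ → State → Set
Fresh z T = ∀ {e} → e ∈ T → z # e

label : Entry → ℕ
label (edge x y) = x ⊔ y
label (x ∶ A)    = x

label<⇒# : ∀ e {z} → label e < z → z # e
label<⇒# (edge x y) l = >⇒≢ (≤-trans (s≤s (m≤m⊔n x y)) l) , >⇒≢ (≤-trans (s≤s (m≤n⊔m x y)) l)
label<⇒# (x ∶ A)    l = >⇒≢ l

bound : State → ℕ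
bound []      = 0
bound (e ∷ T) = suc (label e) ⊔ bound T

bound-fresh : ∀ T {z} → bound T ≤ z → Fresh z T
bound-fresh (e ∷ T) l (here refl) = label<⇒# e (≤-trans (m≤m⊔n (suc (label e)) (bound T)) l)
bound-fresh (e ∷ T) l (there m)   = bound-fresh T (≤-trans (m≤n⊔m (suc (label e)) (bound T)) l) m

rename : (ℕ → ℕ) → Entry → Entry
rename ρ (edge x y) = edge (ρ x) (ρ y)
rename ρ (x ∶ A)    = ρ x ∶ A

rename-id : ∀ e → rename id e ≡ e
rename-id (edge x y) = refl
rename-id (x ∶ A)    = refl

rename-set : ∀ ρ {z} u e → z # e → rename (set ρ z u) e ≡ rename ρ e
rename-set ρ u (edge x y) (z≢x , z≢y) = cong₂ edge (set-≢ ρ u z≢x) (set-≢ ρ u z≢y)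
rename-set ρ u (x ∶ A)    z≢x         = cong (_∶ A) (set-≢ ρ u z≢x)

_⊆[_]_ : State → (ℕ → ℕ) → State → Set
T ⊆[ ρ ] T' = ∀ {e} → e ∈ T → rename ρ e ∈ T'

⊆[]-∷ : ∀ {ρ T T'} e → T ⊆[ ρ ] T' → (e ∷ T) ⊆[ ρ ] (rename ρ e ∷ T')
⊆[]-∷ e s (here refl) = here refl
⊆[]-∷ e s (there m)   = there (s m)

⊆[]-set : ∀ {ρ z u T T'} A x → Fresh z T → z ≢ x → T ⊆[ ρ ] T' →
          (z ∶ A ∷ edge x z ∷ T) ⊆[ set ρ z u ] (u ∶ A ∷ edge (ρ x) u ∷ T')
⊆[]-set {ρ} {z} {u} A x fr z≢x s (here refl)         = here (cong (_∶ A) (set-≡ ρ z u))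
⊆[]-set {ρ} {z} {u} A x fr z≢x s (there (here refl)) =
  there (here (cong₂ edge (set-≢ ρ u z≢x) (set-≡ ρ z u)))
⊆[]-set {ρ} {z} {u} A x fr z≢x s (there (there m)) =
  there (there (subst (_∈ _) (sym (rename-set ρ u _ (fr m))) (s m)))

⊆-∷ : ∀ {T T' : State} e → T ⊆ T' → (e ∷ T) ⊆ (e ∷ T')
⊆-∷ e s (here refl) = here refl
⊆-∷ e s (there m)   = there (s m)

module Labelled (X : AxSet) where

  -- The edge into x in `five-step` encodes the side condition that the first hole lies under a box.
  -- The target y is unconstrained because all labels are finally mapped into one tree.
  data Step (T : State) (x : ℕ) (A : Fm) : Entry → Set where
    k-step    : ∀ {y} → edge x y ∈ T → Step T x A (y ∶ A)
    t-step    : t ∈X X → Step T x A (x ∶ A)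
    b-step    : ∀ {y} → b ∈X X → edge y x ∈ T → Step T x A (y ∶ A)
    four-step : ∀ {y} → four ∈X X → edge x y ∈ T → Step T x A (y ∶ ◇ A)
    five-step : ∀ {w} y → five ∈X X → edge w x ∈ T → Step T x A (y ∶ ◇ A)

  data Der (T : State) : Set where
    axD : ∀ {x p} → x ∶ atom p ∈ T → x ∶ natom p ∈ T → Der T
    ∧D  : ∀ {x A B} → x ∶ (A ∧' B) ∈ T → Der (x ∶ A ∷ T) → Der (x ∶ B ∷ T) → Der T
    ∨D  : ∀ {x A B} → x ∶ (A ∨' B) ∈ T → Der (x ∶ A ∷ x ∶ B ∷ T) → Der T
    □D  : ∀ {x z A} → x ∶ □ A ∈ T → Fresh z T → Der (z ∶ A ∷ edge x z ∷ T) → Der T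
    dD  : ∀ {x z A} → d ∈X X → x ∶ ◇ A ∈ T → Fresh z T → Der (z ∶ A ∷ edge x z ∷ T) → Der T
    ◇D  : ∀ {x A e} → x ∶ ◇ A ∈ T → Step T x A e → Der (e ∷ T) → Der T

  Step-rename : ∀ {ρ T T' x A e} → T ⊆[ ρ ] T' → Step T x A e → Step T' (ρ x) A (rename ρ e)
  Step-rename s (k-step m)        = k-step (s m)
  Step-rename s (t-step p)        = t-step p
  Step-rename s (b-step p m)      = b-step p (s m)
  Step-rename s (four-step p m)   = four-step p (s m)
  Step-rename s (five-step y p m) = five-step _ p (s m)

  -- Weakening alone already requires renaming, because an eigenlabel may occur in the larger state;
  -- it is sent to a label fresh for `T'`. All other side conditions are memberships, so ρ need not
  -- be injective.
  Der-rename : ∀ {ρ T T'} → Der T → T ⊆[ ρ ] T' → Der T'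
  Der-rename (axD m n)    s = axD (s m) (s n)
  Der-rename (∧D m D D')  s = ∧D (s m) (Der-rename D (⊆[]-∷ _ s)) (Der-rename D' (⊆[]-∷ _ s))
  Der-rename (∨D m D)     s = ∨D (s m) (Der-rename D (⊆[]-∷ _ (⊆[]-∷ _ s)))
  Der-rename {T' = T'} (□D m fr D) s =
    □D (s m) (bound-fresh T' ≤-refl) (Der-rename D (⊆[]-set _ _ fr (fr m) s))
  Der-rename {T' = T'} (dD p m fr D) s =
    dD p (s m) (bound-fresh T' ≤-refl) (Der-rename D (⊆[]-set _ _ fr (fr m) s))
  Der-rename (◇D m st D)  s = ◇D (s m) (Step-rename s st) (Der-rename D (⊆[]-∷ _ s))

  weaken : ∀ {T T'} → T ⊆ T' → Der T → Der T'
  weaken s D = Der-rename {ρ = id} D (λ {e} m → subst (_∈ _) (sym (rename-id e)) (s m))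

  -- Without the ◇ that a leaf z obtains first from the rest of the state, z is useless;
  -- with it, z can be created by the d-rule.
  module _ (dX : d ∈X X) {x z : ℕ} (z≢x : z ≢ x) where

    private
      formula : ∀ {T T' y A} → T' ⊆ (edge x z ∷ T) → y ∶ A ∈ T' → y ∶ A ∈ T
      formula s m with s m
      ... | there m' = m'

      grow : ∀ {T T'} e → (edge x z ∷ T) ⊆ T' → (edge x z ∷ e ∷ T) ⊆ (e ∷ T')
      grow e i (here refl)         = there (i (here refl))
      grow e i (there (here refl)) = here refl
      grow e i (there (there m))   = there (i (there m))

      grow' : ∀ {T T'} e → T' ⊆ (edge x z ∷ T) → (e ∷ T') ⊆ (edge x z ∷ e ∷ T)
      grow' e s (here refl) = there (here refl)
      grow' e s (there m) with s m
      ... | here refl = here refl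
      ... | there m'  = there (there m')

      fresh-∷ : ∀ {T} e → z # e → Fresh z T → Fresh z (e ∷ T)
      fresh-∷ e f fr (here refl) = f
      fresh-∷ e f fr (there m)   = fr m

    drop-leaf : ∀ {T T'} → Fresh z T → (edge x z ∷ T) ⊆ T' → T' ⊆ (edge x z ∷ T) → Der T' → Der T
    drop-leaf fr i s (axD m n) = axD (formula s m) (formula s n)
    drop-leaf fr i s (∧D m D D') =
      ∧D m' (drop-leaf (fresh-∷ _ (fr m') fr) (grow _ i) (grow' _ s) D)
            (drop-leaf (fresh-∷ _ (fr m') fr) (grow _ i) (grow' _ s) D')
      where m' = formula s m
    drop-leaf fr i s (∨D m D) =
      ∨D m' (drop-leaf (fresh-∷ _ (fr m') (fresh-∷ _ (fr m') fr))
                       (grow _ (grow _ i)) (grow' _ (grow' _ s)) D)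
      where m' = formula s m
    drop-leaf fr i s (□D m fr' D) =
      □D m' (λ n → fr' (i (there n)))
         (drop-leaf (fresh-∷ _ z≢u (fresh-∷ _ (fr m' , z≢u) fr)) (grow _ (grow _ i)) (grow' _ (grow' _ s)) D)
      where m'  = formula s m
            z≢u = λ z≡u → proj₂ (fr' (i (here refl))) (sym z≡u)
    drop-leaf fr i s (dD p m fr' D) =
      dD p m' (λ n → fr' (i (there n)))
         (drop-leaf (fresh-∷ _ z≢u (fresh-∷ _ (fr m' , z≢u) fr)) (grow _ (grow _ i)) (grow' _ (grow' _ s)) D)
      where m'  = formula s m
            z≢u = λ z≡u → proj₂ (fr' (i (here refl))) (sym z≡u)
    drop-leaf fr i s (◇D m (k-step n) D) with formula s m | s n
    ... | m' | there n'  = ◇D m' (k-step n') (drop-leaf (fresh-∷ _ (proj₂ (fr n')) fr) (grow _ i) (grow' _ s) D)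
    ... | m' | here refl = dD dX m' fr (weaken (⊆-∷ _ s) D)
    drop-leaf fr i s (◇D m (t-step p) D) =
      ◇D m' (t-step p) (drop-leaf (fresh-∷ _ (fr m') fr) (grow _ i) (grow' _ s) D)
      where m' = formula s m
    drop-leaf fr i s (◇D m (b-step p n) D) with formula s m | s n
    ... | m' | there n'  = ◇D m' (b-step p n') (drop-leaf (fresh-∷ _ (proj₁ (fr n')) fr) (grow _ i) (grow' _ s) D)
    ... | m' | here refl = contradiction refl (fr m')
    drop-leaf fr i s (◇D m (four-step p n) D) with formula s m | s n
    ... | m' | there n'  = ◇D m' (four-step p n') (drop-leaf (fresh-∷ _ (proj₂ (fr n')) fr) (grow _ i) (grow' _ s) D)
    ... | m' | here refl =
      dD dX m' fr (◇D (there (there m')) (four-step p (there (here refl)))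
                      (weaken (⊆-∷ _ (there ∘ s)) D))
    drop-leaf fr i s (◇D m (five-step y p n) D) with formula s m | s n | y ≟ z
    ... | m' | here refl | _        = contradiction refl (fr m')
    ... | m' | there n'  | no y≢z   =
      ◇D m' (five-step y p n') (drop-leaf (fresh-∷ _ (y≢z ∘ sym) fr) (grow _ i) (grow' _ s) D)
    ... | m' | there n'  | yes refl =
      -- The leaf z does not exist yet. The formula first moves to x, where d creates z, and only
      -- then from its origin to z.
      ◇D m' (five-step x p n')
        (dD dX (here refl) (fresh-∷ _ z≢x fr)
          (◇D (there (there (there m'))) (five-step z p (there (there (there n'))))
            (weaken (⊆-∷ _ (there ∘ ⊆-∷ _ there ∘ s)) D)))

  -- Accessibility

  _⟶[_]_ : ℕ → State → ℕ → Set
  x ⟶[ T ] y = edge x y ∈ T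

  _~[_]_ : ℕ → State → ℕ → Set
  x ~[ T ] y = EqClosure (_⟶[ T ]_) x y

  -- Carries T x y: the 4- and 5-rules carry ◇ A from x to y;
  -- Touches T x y: the k-, t- and b-rules turn ◇ A at x into A at y.
  data Carries (T : State) (x y : ℕ) : Set where
    four-carries : four ∈X X → x ⟶[ T ] y → Carries T x y
    five-carries : ∀ {w} → five ∈X X → w ⟶[ T ] x → x ~[ T ] y → Carries T x y

  data Touches (T : State) (x y : ℕ) : Set where
    k-touches : x ⟶[ T ] y → Touches T x y
    t-touches : t ∈X X → x ≡ y → Touches T x y
    b-touches : b ∈X X → y ⟶[ T ] x → Touches T x y

  Acc : State → ℕ → ℕ → Set
  Acc T x z = ∃ λ y → Star (Carries T) x y × Touches T y z

  ~-mono : ∀ {T T' x y} → T ⊆ T' → x ~[ T ] y → x ~[ T' ] y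
  ~-mono s = Eq.map s

  Carries-mono : ∀ {T T' x y} → T ⊆ T' → Carries T x y → Carries T' x y
  Carries-mono s (four-carries p m)   = four-carries p (s m)
  Carries-mono s (five-carries p m c) = five-carries p (s m) (~-mono s c)

  Touches-mono : ∀ {T T' x y} → T ⊆ T' → Touches T x y → Touches T' x y
  Touches-mono s (k-touches m)   = k-touches (s m)
  Touches-mono s (t-touches p e) = t-touches p e
  Touches-mono s (b-touches p m) = b-touches p (s m)

  Acc-mono : ∀ {T T' x y} → T ⊆ T' → Acc T x y → Acc T' x y
  Acc-mono s (y , cs , u) = y , Star.map (Carries-mono s) cs , Touches-mono s u

  edge⇒Acc : ∀ {T x y} → x ⟶[ T ] y → Acc T x y
  edge⇒Acc m = _ , ε , k-touches m

  -- The path stays in a fixed S inside T: the 4- and 5-rules along it add copies of `◇ A` but no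
  -- edges, and the touching rule at its end releases A.
  propagate : ∀ {S T x y z A} → S ⊆ T → x ∶ ◇ A ∈ T → Star (Carries S) x y → Touches S y z →
              Der (z ∶ A ∷ T) → Der T
  propagate s m ε (k-touches n)      D = ◇D m (k-step (s n)) D
  propagate s m ε (t-touches p refl) D = ◇D m (t-step p) D
  propagate s m ε (b-touches p n)    D = ◇D m (b-step p (s n)) D
  propagate s m (four-carries p n ◅ cs) u D =
    ◇D m (four-step p (s n)) (propagate (there ∘ s) (here refl) cs u (weaken (⊆-∷ _ there) D))
  propagate s m (five-carries p n _ ◅ cs) u D =
    ◇D m (five-step _ p (s n)) (propagate (there ∘ s) (here refl) cs u (weaken (⊆-∷ _ there) D))

  -- Frame conditions for accessibility

  module Frame (b,4⇒5 : b ∈X X → four ∈X X → five ∈X X)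
               (b,5⇒4 : b ∈X X → five ∈X X → four ∈X X)
               (t,5⇒4 : t ∈X X → five ∈X X → four ∈X X) where

    module _ {T : State} where

      carries⇒~ : ∀ {x y} → Carries T x y → x ~[ T ] y
      carries⇒~ (four-carries _ m)   = fwd m ◅ ε
      carries⇒~ (five-carries _ _ c) = c

      carries*⇒~ : ∀ {x y} → Star (Carries T) x y → x ~[ T ] y
      carries*⇒~ ε        = ε
      carries*⇒~ (c ◅ cs) = carries⇒~ c ◅◅ carries*⇒~ cs

      touches⇒~ : ∀ {x y} → Touches T x y → x ~[ T ] y
      touches⇒~ (k-touches m)      = fwd m ◅ ε
      touches⇒~ (t-touches _ refl) = ε
      touches⇒~ (b-touches _ m)    = bwd m ◅ ε

      acc⇒~ : ∀ {x y} → Acc T x y → x ~[ T ] y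
      acc⇒~ (_ , cs , u) = carries*⇒~ cs ◅◅ touches⇒~ u

      ~-sym : ∀ {x y} → x ~[ T ] y → y ~[ T ] x
      ~-sym = Eq.symmetric _

      -- The first edge decides. If it leaves x, then 4 moves along it to a label with a
      -- predecessor, from which 5 goes anywhere in the component; if it enters x, then 5 applies at
      -- once.
      ~⇒carries* : four ∈X X → five ∈X X → ∀ {x y} → x ~[ T ] y → Star (Carries T) x y
      ~⇒carries* p q ε           = ε
      ~⇒carries* p q (fwd m ◅ c) = four-carries p m ◅ five-carries q m c ◅ ε
      ~⇒carries* p q (bwd m ◅ c) = five-carries q m (bwd m ◅ c) ◅ ε

      t-frame : t ∈X X → FrameCond t ℕ (Acc T)
      t-frame p x = x , ε , t-touches p refl

      -- A single touching step is reversed directly. A carrying step puts both 4 and 5 into X, so y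
      -- carries throughout its component; the last step into x is then the first edge of a
      -- connection from x to y, traversed backwards.
      b-frame : b ∈X X → FrameCond b ℕ (Acc T)
      b-frame p x y (_ , ε , k-touches m)      = y , ε , b-touches p m
      b-frame p x y (_ , ε , t-touches q refl) = x , ε , t-touches q refl
      b-frame p x y (_ , ε , b-touches _ m)    = y , ε , k-touches m
      b-frame p x y r@(_ , c ◅ _ , _)          = back (acc⇒~ r)
        where
        4,5∈X : ∀ {u v} → Carries T u v → four ∈X X × five ∈X X
        4,5∈X (four-carries q _)   = q , b,4⇒5 p q
        4,5∈X (five-carries q _ _) = b,5⇒4 p q , q
        walk : ∀ {w} → w ~[ T ] y → Star (Carries T) y w
        walk w~y = ~⇒carries* (proj₁ (4,5∈X c)) (proj₂ (4,5∈X c)) (~-sym w~y)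
        back : x ~[ T ] y → Acc T y x
        back ε             = r
        back (fwd m ◅ w~y) = _ , walk w~y , b-touches p m
        back (bwd m ◅ w~y) = _ , walk w~y , k-touches m

      four-frame : four ∈X X → FrameCond four ℕ (Acc T)
      four-frame p x y z (_ , cs , k-touches m)      (_ , ds , u) = _ , cs ◅◅ four-carries p m ◅ ds , u
      four-frame p x y z (_ , cs , t-touches _ refl) (_ , ds , u) = _ , cs ◅◅ ds , u
      -- Here y is the parent, and only 5 can carry a `◇` from a child up to it.
      four-frame p x y z (_ , cs , b-touches q m)    (_ , ds , u) =
        _ , cs ◅◅ five-carries (b,4⇒5 q p) m (bwd m ◅ ε) ◅ ds , u

      -- It suffices to carry a `◇` from y to w, the label that touches z. If y was reached along an
      -- edge, that edge is the predecessor 5 asks for; if through b, or through t after some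
      -- carrying, 4 is also in X. Otherwise x and y coincide.
      five-frame : five ∈X X → FrameCond five ℕ (Acc T)
      five-frame p x y z r@(_ , cs , u) r'@(w , ds , v) = go cs u
        where
        y~w : y ~[ T ] w
        y~w = ~-sym (acc⇒~ r) ◅◅ carries*⇒~ ds
        go : ∀ {y'} → Star (Carries T) x y' → Touches T y' y → Acc T y z
        go cs (k-touches m)        = w , five-carries p m y~w ◅ ε , v
        go cs (b-touches q m)      = w , ~⇒carries* (b,5⇒4 q p) p y~w , v
        go ε  (t-touches q refl)   = r'
        go (_ ◅ _) (t-touches q _) = w , ~⇒carries* (t,5⇒4 q p) p y~w , v

      -- This is the semantic content of the 5-rule, from euclideanness alone. The step to `x'`
      -- reflects the positive depth of the first hole: `shift` makes z a successor of `x'`, and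
      -- `along` passes it down to `y₁`.
      five-cluster : five ∈X X → ∀ {x x' y₁ y₂ z} → Acc T x x' → Star (Acc T) x' y₁ →
                     Star (Acc T) x y₂ → Acc T y₂ z → Acc T y₁ z
      five-cluster p r rs₁ rs₂ rz = along rs₁ (shift rs₂ rz r)
        where
        shift : ∀ {x y z a} → Star (Acc T) x y → Acc T y z → Acc T x a → Acc T a z
        shift ε        rz ra = five-frame p _ _ _ ra rz
        shift (r ◅ rs) rz ra = shift rs rz (five-frame p _ _ _ r ra)
        along : ∀ {x y z} → Star (Acc T) x y → Acc T x z → Acc T y z
        along ε        rz = rz
        along (r ◅ rs) rz = along rs (five-frame p _ _ _ r rz)

    -- Orthogonality semantics

    Pred : Set₁
    Pred = State → Set

    -- Negation with `Der` as falsum; quantifying over larger states makes it monotone whatever Q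
    -- is.
    _ᗮ : Pred → Pred
    (Q ᗮ) T = ∀ {T'} → T ⊆ T' → Q T' → Der T'

    -- Each of P and Q is the orthogonal of the other: `clash` with monotonicity gives one
    -- inclusion, `closeˡ` and `closeʳ` give the converse ones.
    record Dual (P Q : Pred) : Set where
      field
        monoˡ  : ∀ {T T'} → T ⊆ T' → P T → P T'
        monoʳ  : ∀ {T T'} → T ⊆ T' → Q T → Q T'
        clash  : ∀ {T} → P T → Q T → Der T
        closeˡ : ∀ {T} → (Q ᗮ) T → P T
        closeʳ : ∀ {T} → (P ᗮ) T → Q T

    open Dual

    dual-sym : ∀ {P Q} → Dual P Q → Dual Q P
    dual-sym D = record
      { monoˡ = monoʳ D ; monoʳ = monoˡ D ; clash = λ q p → clash D p q
      ; closeˡ = closeʳ D ; closeʳ = closeˡ D }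

    ᗮ-mono : ∀ {Q T T'} → T ⊆ T' → (Q ᗮ) T → (Q ᗮ) T'
    ᗮ-mono s h s' = h (s' ∘ s)

    dual-ᗮ : ∀ {Q} → (∀ {T T'} → T ⊆ T' → Q T → Q T') → (∀ {T} → ((Q ᗮ) ᗮ) T → Q T) → Dual Q (Q ᗮ)
    dual-ᗮ {Q} mono close = record
      { monoˡ = mono ; monoʳ = ᗮ-mono {Q} ; clash = λ q h → h id q
      ; closeˡ = close ; closeʳ = λ h → h }

    dual-ᗮᗮ : ∀ Q → (∀ {T T'} → T ⊆ T' → Q T → Q T') → Dual (Q ᗮ) ((Q ᗮ) ᗮ)
    dual-ᗮᗮ Q mono = dual-ᗮ (ᗮ-mono {Q}) (λ h s q → h s (λ s' h' → h' id (mono s' q)))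

    dual-× : ∀ {P P' Q Q'} → Dual P Q → Dual P' Q' → Dual (λ T → P T × P' T) ((λ T → P T × P' T) ᗮ)
    dual-× D D' = dual-ᗮ
      (λ s (p , p') → monoˡ D s p , monoˡ D' s p')
      (λ h → closeˡ D (λ s q → h s (λ s' (p , _) → clash D p (monoʳ D s' q))) ,
             closeˡ D' (λ s q → h s (λ s' (_ , p) → clash D' p (monoʳ D' s' q))))

    All-Acc : (ℕ → Pred) → ℕ → Pred
    All-Acc P x T = ∀ {T'} → T ⊆ T' → ∀ y → Acc T' x y → P y T'

    -- An intersection of biorthogonally closed sets is closed. The accessibility witness survives
    -- the passage to larger states by `Acc-mono`.
    dual-□ : ∀ {P Q : ℕ → Pred} → (∀ x → Dual (P x) (Q x)) → ∀ x → Dual (All-Acc P x) (All-Acc P x ᗮ)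
    dual-□ D x = dual-ᗮ
      (λ s h s' → h (s' ∘ s))
      (λ h s y r → closeˡ (D y) (λ s' q →
        h (s' ∘ s) (λ s'' h' → clash (D y) (h' id y (Acc-mono (s'' ∘ s') r)) (monoʳ (D y) s'' q))))

    Has : Entry → Pred
    Has e T = e ∈ T

    -- Tr A x and Fl A x: the states forcing and refuting A at x.
    Tr Fl : Fm → ℕ → Pred
    Tr (atom p)  x = Has (x ∶ atom p) ᗮ
    Tr (natom p) x = (Has (x ∶ atom p) ᗮ) ᗮ
    Tr (A ∨' B)  x = (λ T → Fl A x T × Fl B x T) ᗮ
    Tr (A ∧' B)  x = λ T → Tr A x T × Tr B x T
    Tr (◇ A)     x = All-Acc (Fl A) x ᗮ
    Tr (□ A)     x = All-Acc (Tr A) x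
    Fl (atom p)  x = (Has (x ∶ atom p) ᗮ) ᗮ
    Fl (natom p) x = Has (x ∶ atom p) ᗮ
    Fl (A ∨' B)  x = λ T → Fl A x T × Fl B x T
    Fl (A ∧' B)  x = (λ T → Tr A x T × Tr B x T) ᗮ
    Fl (◇ A)     x = All-Acc (Fl A) x
    Fl (□ A)     x = All-Acc (Tr A) x ᗮ

    dual : ∀ A x → Dual (Tr A x) (Fl A x)
    dual (atom p)  x = dual-ᗮᗮ (Has (x ∶ atom p)) (λ s → s)
    dual (natom p) x = dual-sym (dual-ᗮᗮ (Has (x ∶ atom p)) (λ s → s))
    dual (A ∨' B)  x = dual-sym (dual-× (dual-sym (dual A x)) (dual-sym (dual B x)))
    dual (A ∧' B)  x = dual-× (dual A x) (dual B x)
    dual (◇ A)     x = dual-sym (dual-□ (λ y → dual-sym (dual A y)) x)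
    dual (□ A)     x = dual-□ (dual A) x

    -- Against a state forcing A, the labelled rule for A is applied and its premises are closed by
    -- clashes at the subformulas. This plays the role of an identity axiom for arbitrary A.
    refute : ∀ A {x T} → x ∶ A ∈ T → Fl A x T
    refute (atom p)  m = λ s h → h id (s m)
    refute (natom p) m = λ s n → axD n (s m)
    refute (A ∨' B) {x} m =
      closeʳ (dual A x) (λ s a → ∨D (s m) (clash (dual A x) (monoˡ (dual A x) (there ∘ there) a) (refute A (here refl)))) ,
      closeʳ (dual B x) (λ s c → ∨D (s m) (clash (dual B x) (monoˡ (dual B x) (there ∘ there) c) (refute B (there (here refl)))))
    refute (A ∧' B) {x} m s (a , c) =
      ∧D (s m) (clash (dual A x) (monoˡ (dual A x) there a) (refute A (here refl)))
               (clash (dual B x) (monoˡ (dual B x) there c) (refute B (here refl)))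
    refute (◇ A) m s y (_ , cs , u) =
      closeʳ (dual A y) (λ s' a → propagate s' (s' (s m)) cs u
        (clash (dual A y) (monoˡ (dual A y) there a) (refute A (here refl))))
    refute (□ A) {x} m {T'} s h =
      □D (s m) fr (clash (dual A (bound T')) (h (there ∘ there) (bound T') (edge⇒Acc (there (here refl))))
                         (refute A (here refl)))
      where
      fr : Fresh (bound T') T'
      fr = bound-fresh T' ≤-refl

    mutual
      -- Together the four lemmas say that negation exchanges `Tr` and `Fl`. Since both sides are
      -- closed, it is enough that like sides of A and `neg A` clash, which is shown by induction on
      -- A.
      Tr-neg-clash : ∀ A {x T} → Tr A x T → Tr (neg A) x T → Der T
      Tr-neg-clash (atom p)  a n       = n id a
      Tr-neg-clash (natom p) a n       = a id n
      Tr-neg-clash (A ∨' B)  h (a , c) = h id (Tr-neg⇒Fl A a , Tr-neg⇒Fl B c)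
      Tr-neg-clash (A ∧' B)  (a , c) h = h id (Tr⇒Fl-neg A a , Tr⇒Fl-neg B c)
      Tr-neg-clash (◇ A)     h a       = h id (λ s y r → Tr-neg⇒Fl A (a s y r))
      Tr-neg-clash (□ A)     a h       = h id (λ s y r → Tr⇒Fl-neg A (a s y r))

      Fl-neg-clash : ∀ A {x T} → Fl A x T → Fl (neg A) x T → Der T
      Fl-neg-clash (atom p)  a n       = a id n
      Fl-neg-clash (natom p) a n       = n id a
      Fl-neg-clash (A ∨' B)  (a , c) h = h id (Fl⇒Tr-neg A a , Fl⇒Tr-neg B c)
      Fl-neg-clash (A ∧' B)  h (a , c) = h id (Fl-neg⇒Tr A a , Fl-neg⇒Tr B c)
      Fl-neg-clash (◇ A)     a h       = h id (λ s y r → Fl⇒Tr-neg A (a s y r))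
      Fl-neg-clash (□ A)     h a       = h id (λ s y r → Fl-neg⇒Tr A (a s y r))

      Tr-neg⇒Fl : ∀ A {x T} → Tr (neg A) x T → Fl A x T
      Tr-neg⇒Fl A {x} n = closeʳ (dual A x) (λ s a → Tr-neg-clash A a (monoˡ (dual (neg A) x) s n))

      Tr⇒Fl-neg : ∀ A {x T} → Tr A x T → Fl (neg A) x T
      Tr⇒Fl-neg A {x} a = closeʳ (dual (neg A) x) (λ s n → Tr-neg-clash A (monoˡ (dual A x) s a) n)

      Fl⇒Tr-neg : ∀ A {x T} → Fl A x T → Tr (neg A) x T
      Fl⇒Tr-neg A {x} a = closeˡ (dual (neg A) x) (λ s n → Fl-neg-clash A (monoʳ (dual A x) s a) n)

      Fl-neg⇒Tr : ∀ A {x T} → Fl (neg A) x T → Tr A x T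
      Fl-neg⇒Tr A {x} n = closeˡ (dual A x) (λ s a → Fl-neg-clash A a (monoʳ (dual (neg A) x) s n))

    -- Soundness of cut

    mutual
      -- Satisfaction means refutation of the sequent as a whole: every formula is refuted, and each
      -- box has an accessible label refuting its content. A provable sequent must therefore yield a
      -- derivation.
      SatI : State → ℕ → Item → Set
      SatI T x (fml A) = Fl A x T
      SatI T x (bx Δ)  = ∃ λ y → Acc T x y × Sat T y Δ

      Sat : State → ℕ → Seq → Set
      Sat T x []      = ⊤
      Sat T x (I ∷ Γ) = SatI T x I × Sat T x Γ

    mutual
      SatI-mono : ∀ {T T' x} → T ⊆ T' → ∀ I → SatI T x I → SatI T' x I
      SatI-mono s (fml A) a           = monoʳ (dual A _) s a
      SatI-mono s (bx Δ)  (y , r , h) = y , Acc-mono s r , Sat-mono s Δ h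

      Sat-mono : ∀ {T T' x} → T ⊆ T' → ∀ Γ → Sat T x Γ → Sat T' x Γ
      Sat-mono s []      _       = tt
      Sat-mono s (I ∷ Γ) (i , h) = SatI-mono s I i , Sat-mono s Γ h

    mutual
      SatI-≈ : ∀ {T x I J} → I ≈ᵢ J → SatI T x J → SatI T x I
      SatI-≈ fml-refl    a           = a
      SatI-≈ (bx-cong p) (y , r , h) = y , r , Sat-≋ p h

      Sat-≋ : ∀ {T x Γ Δ} → Γ ≋ Δ → Sat T x Δ → Sat T x Γ
      Sat-≋ []          _           = tt
      Sat-≋ (cons p q)  (i , h)     = SatI-≈ p i , Sat-≋ q h
      Sat-≋ swap        (i , j , h) = j , i , h
      Sat-≋ (trans p q) h           = Sat-≋ p (Sat-≋ q h)

    Sat-++⁻ : ∀ {T x} Δ {Γ} → Sat T x (Δ ++ Γ) → Sat T x Δ × Sat T x Γ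
    Sat-++⁻ []      h       = tt , h
    Sat-++⁻ (I ∷ Δ) (i , h) = (i , proj₁ (Sat-++⁻ Δ h)) , proj₂ (Sat-++⁻ Δ h)

    Sat-++⁺ : ∀ {T x} Δ {Γ} → Sat T x Δ → Sat T x Γ → Sat T x (Δ ++ Γ)
    Sat-++⁺ []      _       g = g
    Sat-++⁺ (I ∷ Δ) (i , h) g = i , Sat-++⁺ Δ h g

    Path : State → ℕ → ℕ → Set
    Path T = Star (Acc T)

    Path⁺ : State → ℕ → ℕ → Set
    Path⁺ T x y = ∃ λ x' → Acc T x x' × Path T x' y

    Sat-focus : ∀ {T x} C Δ → Sat T x (C ⟨ Δ ⟩) →
                ∃ λ y → Path T x y × Sat T y Δ ×
                        (∀ {T'} → T ⊆ T' → ∀ Δ' → Sat T' y Δ' → Sat T' x (C ⟨ Δ' ⟩))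
    Sat-focus {x = x} (hole Γ) Δ h =
      x , ε , proj₁ (Sat-++⁻ Δ h) ,
      λ s Δ' h' → Sat-++⁺ Δ' h' (Sat-mono s Γ (proj₂ (Sat-++⁻ Δ h)))
    Sat-focus (inbx Γ C) Δ ((x' , r , h) , g) with Sat-focus C Δ h
    ... | y , rs , hy , back =
      y , r ◅ rs , hy , λ s Δ' h' → (x' , Acc-mono s r , back s Δ' h') , Sat-mono s Γ g

    Sat-focus₂ : ∀ {T x} C Δ₁ Δ₂ → Sat T x (C ⟨ Δ₁ ⟩⟨ Δ₂ ⟩) →
                 ∃ λ y₁ → ∃ λ y₂ → Path T x y₁ × (0 < depth2 C → Path⁺ T x y₁) × Path T x y₂ ×
                 Sat T y₁ Δ₁ × (∀ Δ' → Sat T y₂ Δ' → Sat T x (C ⟨ Δ₁ ⟩⟨ Δ' ⟩))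
    Sat-focus₂ {x = x} (here-here Γ) Δ₁ Δ₂ h with Sat-++⁻ Δ₁ h
    ... | h₁ , h' with Sat-++⁻ Δ₂ h'
    ... | h₂ , g = x , x , ε , (λ ()) , ε , h₁ , λ Δ' k → Sat-++⁺ Δ₁ h₁ (Sat-++⁺ Δ' k g)
    Sat-focus₂ {x = x} (here-there Γ C) Δ₁ Δ₂ h with Sat-++⁻ Δ₁ h
    ... | h₁ , (x' , r , h') , g with Sat-focus C Δ₂ h'
    ... | y , rs , hy , back =
      x , y , ε , (λ ()) , r ◅ rs , h₁ , λ Δ' k → Sat-++⁺ Δ₁ h₁ ((x' , r , back id Δ' k) , g)
    Sat-focus₂ {x = x} (there-here Γ C) Δ₁ Δ₂ ((x' , r , h) , h') with Sat-focus C Δ₁ h | Sat-++⁻ Δ₂ h'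
    ... | y , rs , hy , back | h₂ , g =
      y , x , r ◅ rs , (λ _ → x' , r , rs) , ε , hy , λ Δ' k → (x' , r , h) , Sat-++⁺ Δ' k g
    Sat-focus₂ (there-there Γ C C') Δ₁ Δ₂ ((x₁ , r₁ , h₁) , (x₂ , r₂ , h₂) , g)
      with Sat-focus C Δ₁ h₁ | Sat-focus C' Δ₂ h₂
    ... | y₁ , rs₁ , hy₁ , _ | y₂ , rs₂ , hy₂ , back =
      y₁ , y₂ , r₁ ◅ rs₁ , (λ _ → x₁ , r₁ , rs₁) , r₂ ◅ rs₂ , hy₁ ,
      λ Δ' k → (x₁ , r₁ , h₁) , (x₂ , r₂ , back id Δ' k) , g
    Sat-focus₂ (inbx2 Γ C) Δ₁ Δ₂ ((x' , r , h) , g) with Sat-focus₂ C Δ₁ Δ₂ h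
    ... | y₁ , y₂ , p₁ , _ , p₂ , hy , back =
      y₁ , y₂ , r ◅ p₁ , (λ _ → x' , r , p₁) , r ◅ p₂ , hy , λ Δ' k → (x' , r , back Δ' k) , g

    -- This takes the place of seriality: the successor is a new leaf, which `drop-leaf` removes
    -- from the resulting derivation.
    with-successor : d ∈X X → ∀ {T} x → (∀ {T' y} → T ⊆ T' → Acc T' x y → Der T') → Der T
    with-successor p {T} x h =
      drop-leaf p {x} {z} (>⇒≢ (m≤m⊔n (suc x) (bound T))) (bound-fresh T (m≤n⊔m (suc x) (bound T))) id id
                (h there (edge⇒Acc (here refl)))
      where
      -- The bound of T alone would not exclude z = x, because x need not occur in T.
      z = suc x ⊔ bound T

    sound : ∀ {c Γ} → ⊢[ X , c ] Γ → ∀ {T x} → Sat T x Γ → Der T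
    sound (ax C p) h with Sat-focus C _ h
    ... | _ , _ , (a , n , _) , _ = a id n
    sound (∧r C A B D E) h with Sat-focus C _ h
    ... | y , _ , (ab , _) , back =
      ab id ( closeˡ (dual A y) (λ s a → sound D (back s (fml A ∷ []) (a , tt)))
            , closeˡ (dual B y) (λ s c → sound E (back s (fml B ∷ []) (c , tt))))
    sound (∨r C A B D) h with Sat-focus C _ h
    ... | _ , _ , ((a , c) , _) , back = sound D (back id (fml A ∷ fml B ∷ []) (a , c , tt))
    sound (□r C A D) h with Sat-focus C _ h
    ... | _ , _ , (a , _) , back =
      a id (λ s z r → closeˡ (dual A z) (λ s' n →
        sound D (back (s' ∘ s) [ bx [ fml A ] ] ((z , Acc-mono s' r , n , tt) , tt))))
    sound (◇k C A Δ D) h with Sat-focus C _ h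
    ... | _ , _ , (a , (z , r , g) , _) , back =
      sound D (back id (fml (◇ A) ∷ bx (fml A ∷ Δ) ∷ []) (a , (z , r , a id z r , g) , tt))
    sound (◇d p C A D) h with Sat-focus C _ h
    ... | y , _ , (a , _) , back =
      with-successor p y (λ {T'} {z} s r →
        sound D (back s (fml (◇ A) ∷ bx [ fml A ] ∷ [])
                        (monoʳ (dual (◇ A) y) s a , (z , r , a s z r , tt) , tt)))
    sound (◇t p C A D) h with Sat-focus C _ h
    ... | y , _ , (a , _) , back =
      sound D (back id (fml (◇ A) ∷ fml A ∷ []) (a , a id y (t-frame p y) , tt))
    sound (◇b p C A Δ D) h with Sat-focus C _ h
    ... | y , _ , ((z , r , a , g) , _) , back =
      sound D (back id (bx (fml (◇ A) ∷ Δ) ∷ fml A ∷ []) ((z , r , a , g) , a id y (b-frame p y z r) , tt))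
    sound (◇4 p C A Δ D) h with Sat-focus C _ h
    ... | y , _ , (a , (z , r , g) , _) , back =
      sound D (back id (fml (◇ A) ∷ bx (fml (◇ A) ∷ Δ) ∷ [])
        (a , (z , r , (λ s u r' → a s u (four-frame p y z u (Acc-mono s r) r')) , g) , tt))
    sound (◇5 p C A 0<d D) h with Sat-focus₂ C _ _ h
    ... | _ , _ , _ , p⁺ , p₂ , (a , _) , back with p⁺ 0<d
    ... | _ , r , p₁ =
      sound D (back [ fml (◇ A) ]
        ((λ s u r' → a s u (five-cluster p (Acc-mono s r) (Star.map (Acc-mono s) p₁)
                                         (Star.map (Acc-mono s) p₂) r')) , tt))
    sound (cutr _ C A D E) h with Sat-focus C [] h
    ... | y , _ , _ , back =
      -- By D every extension refuting A is derivable, so A is forced here; its negation is then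
      -- refuted, as E requires.
      sound E (back id [ fml (neg A) ]
        (Tr⇒Fl-neg A (closeˡ (dual A y) (λ s a → sound D (back s [ fml A ] (a , tt)))) , tt))
    sound (exch e D) h = sound D (Sat-≋ e h)

-- Nested sequents as labelled trees

mutual
  ≈ᵢ-refl : ∀ {I} → I ≈ᵢ I
  ≈ᵢ-refl {fml A} = fml-refl
  ≈ᵢ-refl {bx Γ}  = bx-cong ≋-refl

  ≋-refl : ∀ {Γ} → Γ ≋ Γ
  ≋-refl {[]}    = []
  ≋-refl {I ∷ Γ} = cons ≈ᵢ-refl ≋-refl

mutual
  ≈ᵢ-sym : ∀ {I J} → I ≈ᵢ J → J ≈ᵢ I
  ≈ᵢ-sym fml-refl    = fml-refl
  ≈ᵢ-sym (bx-cong p) = bx-cong (≋-sym p)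

  ≋-sym : ∀ {Γ Δ} → Γ ≋ Δ → Δ ≋ Γ
  ≋-sym []          = []
  ≋-sym (cons i p)  = cons (≈ᵢ-sym i) (≋-sym p)
  ≋-sym swap        = swap
  ≋-sym (trans p q) = trans (≋-sym q) (≋-sym p)

≡⇒≋ : ∀ {Γ Δ} → Γ ≡ Δ → Γ ≋ Δ
≡⇒≋ refl = ≋-refl

↭⇒≋ : ∀ {Γ Δ} → Γ ↭ Δ → Γ ≋ Δ
↭⇒≋ Perm.refl         = ≋-refl
↭⇒≋ (Perm.prep I p)   = cons ≈ᵢ-refl (↭⇒≋ p)
↭⇒≋ (Perm.swap I J p) = trans swap (cons ≈ᵢ-refl (cons ≈ᵢ-refl (↭⇒≋ p)))
↭⇒≋ (Perm.trans p q)  = trans (↭⇒≋ p) (↭⇒≋ q)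

++-congʳ : ∀ Γ {Δ Δ'} → Δ ≋ Δ' → (Γ ++ Δ) ≋ (Γ ++ Δ')
++-congʳ []      p = p
++-congʳ (I ∷ Γ) p = cons ≈ᵢ-refl (++-congʳ Γ p)

++-congˡ : ∀ {Γ Γ'} Δ → Γ ≋ Γ' → (Γ ++ Δ) ≋ (Γ' ++ Δ)
++-congˡ Δ []          = ≋-refl
++-congˡ Δ (cons i p)  = cons i (++-congˡ Δ p)
++-congˡ Δ swap        = swap
++-congˡ Δ (trans p q) = trans (++-congˡ Δ p) (++-congˡ Δ q)

++-cong : ∀ {Γ Γ' Δ Δ'} → Γ ≋ Γ' → Δ ≋ Δ' → (Γ ++ Δ) ≋ (Γ' ++ Δ')
++-cong {Γ' = Γ'} {Δ = Δ} p q = trans (++-congˡ Δ p) (++-congʳ Γ' q)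

≋-commutativeMonoid : CommutativeMonoid _ _
≋-commutativeMonoid = record
  { Carrier = Seq ; _≈_ = _≋_ ; _∙_ = _++_ ; ε = []
  ; isCommutativeMonoid = record
    { isMonoid = record
      { isSemigroup = record
        { isMagma = record
          { isEquivalence = record { refl = ≋-refl ; sym = ≋-sym ; trans = trans }
          ; ∙-cong = ++-cong }
        ; assoc = λ Γ Δ Θ → ≡⇒≋ (++-assoc Γ Δ Θ) }
      ; identity = (λ Γ → ≋-refl) , (λ Γ → ≡⇒≋ (++-identityʳ Γ)) }
    ; comm = λ Γ Δ → ↭⇒≋ (++-comm Γ Δ) } }

open import Algebra.Solver.CommutativeMonoid ≋-commutativeMonoid using (solve; _⊜_) renaming (_⊕_ to _∙_)

++-exchange : ∀ Γ Δ Θ → (Γ ++ Δ ++ Θ) ≋ (Δ ++ Γ ++ Θ)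
++-exchange = solve 3 (λ Γ Δ Θ → Γ ∙ (Δ ∙ Θ) ⊜ Δ ∙ (Γ ∙ Θ)) ≋-refl

-- Composition of unary and binary contexts

⟨⟩-cong : ∀ C {Γ Δ} → Γ ≋ Δ → (C ⟨ Γ ⟩) ≋ (C ⟨ Δ ⟩)
⟨⟩-cong (hole Θ)   p = ++-cong p ≋-refl
⟨⟩-cong (inbx Θ C) p = cons (bx-cong (⟨⟩-cong C p)) ≋-refl

_+ᶜ_ : Ctx → Seq → Ctx
hole Γ   +ᶜ Θ = hole (Γ ++ Θ)
inbx Γ C +ᶜ Θ = inbx (Γ ++ Θ) C

+ᶜ-⟨⟩ : ∀ C Θ Δ → ((C +ᶜ Θ) ⟨ Δ ⟩) ≡ (C ⟨ Δ ⟩) ++ Θ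
+ᶜ-⟨⟩ (hole Γ)   Θ Δ = sym (++-assoc Δ Γ Θ)
+ᶜ-⟨⟩ (inbx Γ C) Θ Δ = refl

_∘ᶜ_ : Ctx → Ctx → Ctx
hole Γ   ∘ᶜ D = D +ᶜ Γ
inbx Γ C ∘ᶜ D = inbx Γ (C ∘ᶜ D)

∘ᶜ-⟨⟩ : ∀ C D Δ → ((C ∘ᶜ D) ⟨ Δ ⟩) ≡ (C ⟨ D ⟨ Δ ⟩ ⟩)
∘ᶜ-⟨⟩ (hole Γ)   D Δ = +ᶜ-⟨⟩ D Γ Δ
∘ᶜ-⟨⟩ (inbx Γ C) D Δ = cong (λ Θ → bx Θ ∷ Γ) (∘ᶜ-⟨⟩ C D Δ)

_+₂_ : Ctx2 → Seq → Ctx2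
here-here Γ        +₂ Θ = here-here (Γ ++ Θ)
here-there Γ C     +₂ Θ = here-there (Γ ++ Θ) C
there-here Γ C     +₂ Θ = there-here (Γ ++ Θ) C
there-there Γ C C' +₂ Θ = there-there (Γ ++ Θ) C C'
inbx2 Γ C          +₂ Θ = inbx2 (Γ ++ Θ) C

+₂-⟨⟩ : ∀ C Θ Δ₁ Δ₂ → ((C +₂ Θ) ⟨ Δ₁ ⟩⟨ Δ₂ ⟩) ≡ (C ⟨ Δ₁ ⟩⟨ Δ₂ ⟩) ++ Θ
+₂-⟨⟩ (here-here Γ)        Θ Δ₁ Δ₂
  rewrite ++-assoc Δ₁ (Δ₂ ++ Γ) Θ | ++-assoc Δ₂ Γ Θ = refl
+₂-⟨⟩ (here-there Γ C)     Θ Δ₁ Δ₂ = sym (++-assoc Δ₁ (bx (C ⟨ Δ₂ ⟩) ∷ Γ) Θ)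
+₂-⟨⟩ (there-here Γ C)     Θ Δ₁ Δ₂ = cong (bx (C ⟨ Δ₁ ⟩) ∷_) (sym (++-assoc Δ₂ Γ Θ))
+₂-⟨⟩ (there-there Γ C C') Θ Δ₁ Δ₂ = refl
+₂-⟨⟩ (inbx2 Γ C)          Θ Δ₁ Δ₂ = refl

+₂-depth : ∀ C Θ → depth2 (C +₂ Θ) ≡ depth2 C
+₂-depth (here-here Γ)        Θ = refl
+₂-depth (here-there Γ C)     Θ = refl
+₂-depth (there-here Γ C)     Θ = refl
+₂-depth (there-there Γ C C') Θ = refl
+₂-depth (inbx2 Γ C)          Θ = refl

_∘₂_ : Ctx → Ctx2 → Ctx2
hole Γ   ∘₂ D = D +₂ Γ
inbx Γ C ∘₂ D = inbx2 Γ (C ∘₂ D)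

∘₂-⟨⟩ : ∀ C D Δ₁ Δ₂ → ((C ∘₂ D) ⟨ Δ₁ ⟩⟨ Δ₂ ⟩) ≡ (C ⟨ D ⟨ Δ₁ ⟩⟨ Δ₂ ⟩ ⟩)
∘₂-⟨⟩ (hole Γ)   D Δ₁ Δ₂ = +₂-⟨⟩ D Γ Δ₁ Δ₂
∘₂-⟨⟩ (inbx Γ C) D Δ₁ Δ₂ = cong (λ Θ → bx Θ ∷ Γ) (∘₂-⟨⟩ C D Δ₁ Δ₂)

∘₂-depth : ∀ C D → 0 < depth2 D → 0 < depth2 (C ∘₂ D)
∘₂-depth (hole Γ)   D p = subst (0 <_) (sym (+₂-depth D Γ)) p
∘₂-depth (inbx Γ C) D p = s≤s z≤n

join : Ctx → Ctx → Seq → Ctx2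
join (hole Γ)   (hole Δ)    Θ = here-here (Γ ++ Δ ++ Θ)
join (hole Γ)   (inbx Δ C)  Θ = here-there (Γ ++ Δ ++ Θ) C
join (inbx Γ C) (hole Δ)    Θ = there-here (Γ ++ Δ ++ Θ) C
join (inbx Γ C) (inbx Δ C') Θ = there-there (Γ ++ Δ ++ Θ) C C'

join-⟨⟩ : ∀ C D Θ Δ₁ Δ₂ → ((C ⟨ Δ₁ ⟩) ++ (D ⟨ Δ₂ ⟩) ++ Θ) ≋ (join C D Θ ⟨ Δ₁ ⟩⟨ Δ₂ ⟩)
join-⟨⟩ (hole Γ) (hole Δ) Θ Δ₁ Δ₂ =
  solve 5 (λ Γ Δ Θ Δ₁ Δ₂ → (Δ₁ ∙ Γ) ∙ ((Δ₂ ∙ Δ) ∙ Θ) ⊜ Δ₁ ∙ (Δ₂ ∙ (Γ ∙ (Δ ∙ Θ)))) ≋-refl Γ Δ Θ Δ₁ Δ₂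
join-⟨⟩ (hole Γ) (inbx Δ C) Θ Δ₁ Δ₂ =
  solve 5 (λ Γ Δ Θ Δ₁ B → (Δ₁ ∙ Γ) ∙ (B ∙ (Δ ∙ Θ)) ⊜ Δ₁ ∙ (B ∙ (Γ ∙ (Δ ∙ Θ)))) ≋-refl
        Γ Δ Θ Δ₁ [ bx (C ⟨ Δ₂ ⟩) ]
join-⟨⟩ (inbx Γ C) (hole Δ) Θ Δ₁ Δ₂ = cons ≈ᵢ-refl
  (solve 4 (λ Γ Δ Θ Δ₂ → Γ ∙ ((Δ₂ ∙ Δ) ∙ Θ) ⊜ Δ₂ ∙ (Γ ∙ (Δ ∙ Θ))) ≋-refl Γ Δ Θ Δ₂)
join-⟨⟩ (inbx Γ C) (inbx Δ C') Θ Δ₁ Δ₂ = cons ≈ᵢ-refl (++-exchange Γ [ bx (C' ⟨ Δ₂ ⟩) ] (Δ ++ Θ))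

join-depth : ∀ C D Θ → depth2 (join C D Θ) ≡ depth C
join-depth (hole Γ)   (hole Δ)    Θ = refl
join-depth (hole Γ)   (inbx Δ C)  Θ = refl
join-depth (inbx Γ C) (hole Δ)    Θ = refl
join-depth (inbx Γ C) (inbx Δ C') Θ = refl

-- A tree with root 0, given by its edges (parent , child), each of which attaches
-- a new leaf to the tree formed by the edges listed after it.
Tree : Set
Tree = List (ℕ × ℕ)

Node : Tree → ℕ → Set
Node []             v = v ≡ 0
Node ((u , y) ∷ es) v = v ≡ y ⊎ Node es v

Good : Tree → Set
Good []             = ⊤
Good ((u , y) ∷ es) = ¬ Node es y × Node es u × Good es

Node-root : ∀ es → Node es 0
Node-root []       = refl
Node-root (_ ∷ es) = inj₂ (Node-root es)

edge-source : ∀ {es u y} → Good es → (u , y) ∈ es → Node es u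
edge-source (_ , u∈ , _) (here refl) = inj₂ u∈
edge-source (_ , _ , g)  (there m)   = inj₂ (edge-source g m)

edge-target : ∀ {es u y} → Good es → (u , y) ∈ es → Node es y
edge-target g           (here refl) = inj₁ refl
edge-target (_ , _ , g) (there m)   = inj₂ (edge-target g m)

edge-target-≢0 : ∀ {es u y} → Good es → (u , y) ∈ es → y ≢ 0
edge-target-≢0 {_ ∷ es} (y∉ , _ , _) (here refl) refl = y∉ (Node-root es)
edge-target-≢0 (_ , _ , g) (there m) y≡0 = edge-target-≢0 g m y≡0

Node? : ∀ es v → Dec (Node es v)
Node? []             v = v ≟ 0
Node? ((u , y) ∷ es) v = (v ≟ y) ⊎-dec Node? es v

treeBound : Tree → ℕ
treeBound []             = 1
treeBound ((u , y) ∷ es) = suc y ⊔ treeBound es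

Node<treeBound : ∀ es {v} → Node es v → v < treeBound es
Node<treeBound []             refl        = s≤s z≤n
Node<treeBound ((u , y) ∷ es) (inj₁ refl) = m≤m⊔n (suc y) (treeBound es)
Node<treeBound ((u , y) ∷ es) (inj₂ n)    = ≤-trans (Node<treeBound es n) (m≤n⊔m (suc y) (treeBound es))

treeBound∉ : ∀ es → ¬ Node es (treeBound es)
treeBound∉ es n = <⇒≢ (Node<treeBound es n) refl

_≋[_]_ : (ℕ → Seq) → Tree → (ℕ → Seq) → Set
fs ≋[ es ] gs = ∀ {w} → Node es w → fs w ≋ gs w

_⊕_ : (ℕ → Seq) → (ℕ → Seq) → ℕ → Seq
(fs ⊕ gs) w = fs w ++ gs w

abstract

  at : ℕ → Seq → ℕ → Seq
  at u Σ w with w ≟ u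
  ... | yes _ = Σ
  ... | no _  = []

  put : ℕ → Seq → (ℕ → Seq) → ℕ → Seq
  put u Σ fs w = at u Σ w ++ fs w

  at-≡ : ∀ u Σ → at u Σ u ≡ Σ
  at-≡ u Σ with u ≟ u
  ... | yes _  = refl
  ... | no u≢u = contradiction refl u≢u

  at-≢ : ∀ u Σ {w} → w ≢ u → at u Σ w ≡ []
  at-≢ u Σ {w} w≢u with w ≟ u
  ... | yes w≡u = contradiction w≡u w≢u
  ... | no _    = refl

  at-cong : ∀ u {Σ Σ'} w → Σ ≋ Σ' → at u Σ w ≋ at u Σ' w
  at-cong u w p with w ≟ u
  ... | yes _ = p
  ... | no _  = []

  at-++ : ∀ u Σ Σ' w → at u (Σ ++ Σ') w ≡ at u Σ w ++ at u Σ' w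
  at-++ u Σ Σ' w with w ≟ u
  ... | yes _ = refl
  ... | no _  = refl

  at-[] : ∀ u w → at u [] w ≡ []
  at-[] u w with w ≟ u
  ... | yes _ = refl
  ... | no _  = refl

  put-≡ : ∀ u Σ fs → put u Σ fs u ≡ Σ ++ fs u
  put-≡ u Σ fs = cong (_++ fs u) (at-≡ u Σ)

  put-≢ : ∀ u Σ fs {w} → w ≢ u → put u Σ fs w ≡ fs w
  put-≢ u Σ fs {w} w≢u = cong (_++ fs w) (at-≢ u Σ w≢u)

  put-[] : ∀ u fs w → put u [] fs w ≡ fs w
  put-[] u fs w = cong (_++ fs w) (at-[] u w)

  put-cong : ∀ {es fs gs} u {Σ Σ'} → Σ ≋ Σ' → fs ≋[ es ] gs → put u Σ fs ≋[ es ] put u Σ' gs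
  put-cong u p q {w} w∈ = ++-cong (at-cong u w p) (q w∈)

  put-comm : ∀ u Σ v Σ' fs w → put u Σ (put v Σ' fs) w ≋ put v Σ' (put u Σ fs) w
  put-comm u Σ v Σ' fs w = ++-exchange (at u Σ w) (at v Σ' w) (fs w)

  put-put : ∀ u Σ Σ' fs w → put u Σ (put u Σ' fs) w ≡ put u (Σ ++ Σ') fs w
  put-put u Σ Σ' fs w =
    ≡.trans (sym (++-assoc (at u Σ w) (at u Σ' w) (fs w))) (cong (_++ fs w) (sym (at-++ u Σ Σ' w)))

  put-⊕ˡ : ∀ u Σ fs gs w → (put u Σ fs ⊕ gs) w ≡ put u Σ (fs ⊕ gs) w
  put-⊕ˡ u Σ fs gs w = ++-assoc (at u Σ w) (fs w) (gs w)

  put-⊕ʳ : ∀ u Σ fs gs w → (fs ⊕ put u Σ gs) w ≋ put u Σ (fs ⊕ gs) w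
  put-⊕ʳ u Σ fs gs w = ++-exchange (fs w) (at u Σ w) (gs w)

  put-∈ʳ : ∀ u Σ fs {w I} → I ∈ fs w → I ∈ put u Σ fs w
  put-∈ʳ u Σ fs {w} m = ∈-++⁺ʳ (at u Σ w) m

put-∈ˡ : ∀ u {Σ} fs {I} → I ∈ Σ → I ∈ put u Σ fs u
put-∈ˡ u {Σ} fs m = subst (_ ∈_) (sym (put-≡ u Σ fs)) (∈-++⁺ˡ m)

put-leaf : ∀ {es y} Σ fs → ¬ Node es y → put y Σ fs ≋[ es ] fs
put-leaf {y = y} Σ fs y∉ w∈ = ≡⇒≋ (put-≢ y Σ fs (λ { refl → y∉ w∈ }))

-- Every edge packs the content of its leaf into a box and moves the box to the parent.
dec : Tree → (ℕ → Seq) → Seq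
dec []             fs = fs 0
dec ((u , y) ∷ es) fs = dec es (put u [ bx (fs y) ] fs)

dec-cong : ∀ es {fs gs} → Good es → fs ≋[ es ] gs → dec es fs ≋ dec es gs
dec-cong []             g            p = p refl
dec-cong ((u , y) ∷ es) (_ , _ , g) p =
  dec-cong es g (put-cong u (cons (bx-cong (p (inj₁ refl))) []) (λ w∈ → p (inj₂ w∈)))

-- The context is chosen before Σ, so that the premises and the conclusion of a rule share it.
dec-focus : ∀ es {u} → Good es → Node es u → ∀ fs →
            ∃ λ C → ∀ Σ → dec es (put u Σ fs) ≋ (C ⟨ Σ ⟩)
dec-focus []             _ refl fs = hole (fs 0) , λ Σ → ≡⇒≋ (put-≡ 0 Σ fs)
dec-focus ((v , y) ∷ es) {u} (y∉ , v∈ , g) u∈ fs with u ≟ y | u∈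
... | yes refl | _ =
  let C , eq = dec-focus es g v∈ fs in
  C ∘ᶜ inbx [] (hole (fs y)) , λ Σ →
    trans (dec-cong es g (put-cong v (cons (bx-cong (≡⇒≋ (put-≡ y Σ fs))) []) (put-leaf Σ fs y∉)))
    (trans (eq [ bx (Σ ++ fs y) ]) (≡⇒≋ (sym (∘ᶜ-⟨⟩ C _ Σ))))
... | no u≢y | inj₁ u≡y = contradiction u≡y u≢y
... | no u≢y | inj₂ u∈' =
  let C , eq = dec-focus es g u∈' (put v [ bx (fs y) ] fs) in
  C , λ Σ →
    trans (dec-cong es g (λ {w} w∈ →
      trans (put-cong v (cons (bx-cong (≡⇒≋ (put-≢ u Σ fs (u≢y ∘ sym)))) []) (λ _ → ≋-refl) w∈)
            (put-comm v _ u Σ fs w)))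
    (eq Σ)

dec-focus-edge : ∀ es {u y} → Good es → (u , y) ∈ es → ∀ fs →
                 ∃ λ C → ∃ λ Θ → ∀ Σ₁ Σ₂ →
                 dec es (put u Σ₁ (put y Σ₂ fs)) ≋ (C ⟨ Σ₁ ++ [ bx (Σ₂ ++ Θ) ] ⟩)
dec-focus-edge ((u , y) ∷ es) (y∉ , u∈ , g) (here refl) fs =
  let C , eq = dec-focus es g u∈ fs in
  C , fs y , λ Σ₁ Σ₂ →
    trans (dec-cong es g (λ {w} w∈ →
      trans (put-cong u (cons (bx-cong (≡⇒≋ (≡.trans (put-≢ u Σ₁ _ (λ { refl → y∉ u∈ })) (put-≡ y Σ₂ fs)))) [])
                        (put-cong u ≋-refl (put-leaf Σ₂ fs y∉)) w∈)
      (trans (≡⇒≋ (put-put u _ Σ₁ fs w))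
             (put-cong u (↭⇒≋ (++-comm [ bx (Σ₂ ++ fs y) ] Σ₁)) (λ _ → ≋-refl) w∈))))
    (eq _)
dec-focus-edge ((v , z) ∷ es) {u} {y} (z∉ , v∈ , g) (there m) fs =
  let C , Θ , eq = dec-focus-edge es g m (put v [ bx (fs z) ] fs) in
  C , Θ , λ Σ₁ Σ₂ →
    trans (dec-cong es g (λ {w} w∈ →
      trans (put-cong v (cons (bx-cong (≡⇒≋ (≡.trans (put-≢ u Σ₁ _ z≢u) (put-≢ y Σ₂ fs z≢y)))) [])
                        (λ _ → ≋-refl) w∈)
      (trans (put-comm v _ u Σ₁ _ w)
             (put-cong u ≋-refl (λ {w} _ → put-comm v _ y Σ₂ fs w) w∈))))
    (eq Σ₁ Σ₂)
  where
  z≢u : z ≢ u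
  z≢u refl = z∉ (edge-source g m)
  z≢y : z ≢ y
  z≢y refl = z∉ (edge-target g m)

-- C and D hold what has already been folded around the two holes. The disjunction is the invariant
-- behind the depth bound: either x is still below the root or a box already encloses the first
-- hole.
dec-focus₂ : ∀ es {x y} → Good es → Node es x → Node es y → ∀ fs C D → x ≢ 0 ⊎ 0 < depth C →
             ∃ λ E → 0 < depth2 E ×
             (∀ Σ₁ Σ₂ → dec es (put x (C ⟨ Σ₁ ⟩) (put y (D ⟨ Σ₂ ⟩) fs)) ≋ (E ⟨ Σ₁ ⟩⟨ Σ₂ ⟩))
dec-focus₂ [] _ refl refl fs C D (inj₁ 0≢0) = contradiction refl 0≢0
dec-focus₂ [] _ refl refl fs C D (inj₂ p) =
  join C D (fs 0) , subst (0 <_) (sym (join-depth C D (fs 0))) p , λ Σ₁ Σ₂ →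
    trans (≡⇒≋ (≡.trans (put-≡ 0 _ _) (cong ((C ⟨ Σ₁ ⟩) ++_) (put-≡ 0 _ fs)))) (join-⟨⟩ C D (fs 0) Σ₁ Σ₂)
dec-focus₂ ((v , z) ∷ es) {x} {y} (z∉ , v∈ , g) x∈ y∈ fs C D p with x ≟ z | y ≟ z | x∈ | y∈
... | no x≢z | _ | inj₁ x≡z | _ = contradiction x≡z x≢z
... | _ | no y≢z | _ | inj₁ y≡z = contradiction y≡z y≢z
... | yes refl | yes refl | _ | _ =
  let E , eq = dec-focus es g v∈ fs in
  E ∘₂ inbx2 [] (join C D (fs z)) , ∘₂-depth E _ (s≤s z≤n) , λ Σ₁ Σ₂ →
    trans (dec-cong es g (put-cong v
      (cons (bx-cong (trans (≡⇒≋ (≡.trans (put-≡ z _ _) (cong ((C ⟨ Σ₁ ⟩) ++_) (put-≡ z _ fs))))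
                            (join-⟨⟩ C D (fs z) Σ₁ Σ₂))) [])
      (λ w∈ → trans (put-leaf _ _ z∉ w∈) (put-leaf _ fs z∉ w∈))))
    (trans (eq _) (≡⇒≋ (sym (∘₂-⟨⟩ E _ Σ₁ Σ₂))))
... | yes refl | no y≢z | _ | inj₂ y∈' =
  let E , q , eq = dec-focus₂ es g v∈ y∈' fs (inbx [] (C +ᶜ fs z)) D (inj₂ (s≤s z≤n)) in
  E , q , λ Σ₁ Σ₂ →
    trans (dec-cong es g (put-cong v
      (cons (bx-cong (≡⇒≋ (≡.trans (put-≡ z _ _)
        (≡.trans (cong ((C ⟨ Σ₁ ⟩) ++_) (put-≢ y _ fs (y≢z ∘ sym))) (sym (+ᶜ-⟨⟩ C (fs z) Σ₁)))))) [])
      (put-leaf _ _ z∉)))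
    (eq Σ₁ Σ₂)
... | no x≢z | yes refl | inj₂ x∈' | _ =
  let E , q , eq = dec-focus₂ es g x∈' v∈ fs C (inbx [] (D +ᶜ fs z)) p in
  E , q , λ Σ₁ Σ₂ →
    trans (dec-cong es g (λ {w} w∈ →
      trans (put-cong v
        (cons (bx-cong (≡⇒≋ (≡.trans (put-≢ x _ _ (x≢z ∘ sym))
          (≡.trans (put-≡ z _ fs) (sym (+ᶜ-⟨⟩ D (fs z) Σ₂)))))) [])
        (put-cong x ≋-refl (put-leaf _ fs z∉)) w∈)
      (put-comm v _ x _ fs w)))
    (eq Σ₁ Σ₂)
... | no x≢z | no y≢z | inj₂ x∈' | inj₂ y∈' =
  let E , q , eq = dec-focus₂ es g x∈' y∈' (put v [ bx (fs z) ] fs) C D p in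
  E , q , λ Σ₁ Σ₂ →
    trans (dec-cong es g (λ {w} w∈ →
      trans (put-cong v (cons (bx-cong (≡⇒≋ (≡.trans (put-≢ x _ _ (x≢z ∘ sym)) (put-≢ y _ fs (y≢z ∘ sym))))) [])
                        (λ _ → ≋-refl) w∈)
      (trans (put-comm v _ x _ _ w)
             (put-cong x ≋-refl (λ {w} _ → put-comm v _ y _ fs w) w∈))))
    (eq Σ₁ Σ₂)

set-∈ˡ : ∀ (fs : ℕ → Seq) z {Σ I} → I ∈ Σ → I ∈ set fs z Σ z
set-∈ˡ fs z {Σ} m = subst (_ ∈_) (sym (set-≡ fs z Σ)) m

set-∈ʳ : ∀ (fs : ℕ → Seq) {z Σ w I} → z ≢ w → I ∈ fs w → I ∈ set fs z Σ w
set-∈ʳ fs {Σ = Σ} z≢w m = subst (_ ∈_) (sym (set-≢ fs Σ z≢w)) m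

-- From labelled to nested derivations

extract : ∀ {I Γ} → I ∈ Γ → ∃ λ Δ → Γ ≋ (I ∷ Δ) × (∀ {J} → J ∈ Γ → J ≡ I ⊎ J ∈ Δ)
extract {Γ = _ ∷ Γ} (here refl) = Γ , ≋-refl , λ { (here eq) → inj₁ eq ; (there m) → inj₂ m }
extract {Γ = I' ∷ _} (there m) with extract m
... | Δ , p , split = I' ∷ Δ , trans (cons ≈ᵢ-refl p) swap ,
  λ { (here eq) → inj₂ (here eq) ; (there m') → [ inj₁ , inj₂ ∘ there ]′ (split m') }

isolate : ∀ fs {u F} → F ∈ fs u →
          ∃ λ gs → (∀ w → fs w ≋ put u [ F ] gs w) ×
                   (∀ {w J} → J ∈ fs w → (w ≡ u × J ≡ F) ⊎ J ∈ gs w)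
isolate fs {u} {F} m with extract m
... | Δ , p , split = set fs u Δ , eq , split'
  where
  eq : ∀ w → fs w ≋ put u [ F ] (set fs u Δ) w
  eq w with w ≟ u
  ... | yes refl = trans p (≡⇒≋ (sym (≡.trans (put-≡ u _ _) (cong (F ∷_) (set-≡ fs u Δ)))))
  ... | no w≢u   = ≡⇒≋ (sym (≡.trans (put-≢ u _ _ w≢u) (set-≢ fs Δ (w≢u ∘ sym))))
  split' : ∀ {w J} → J ∈ fs w → (w ≡ u × J ≡ F) ⊎ J ∈ set fs u Δ w
  split' {w} m' with w ≟ u
  ... | no _     = inj₂ m'
  ... | yes refl = [ inj₁ ∘ (refl ,_) , inj₂ ]′ (split m')

-- Cov es fs x A: the node x contains A or what remains of A after rules that decompose
-- formulas. With this notion of occurrence, weakening, contraction and the inversion of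
-- rules need no separate proofs.
data Cov (es : Tree) (fs : ℕ → Seq) : ℕ → Fm → Set where
  occurs : ∀ {x A} → Node es x → fml A ∈ fs x → Cov es fs x A
  ∨-cov  : ∀ {x A B} → Cov es fs x A → Cov es fs x B → Cov es fs x (A ∨' B)
  ∧-covˡ : ∀ {x A B} → Cov es fs x A → Cov es fs x (A ∧' B)
  ∧-covʳ : ∀ {x A B} → Cov es fs x B → Cov es fs x (A ∧' B)
  □-cov  : ∀ {x y A} → (x , y) ∈ es → Cov es fs y A → Cov es fs x (□ A)

_≼_ : Tree × (ℕ → Seq) → Tree × (ℕ → Seq) → Set
(es , fs) ≼ (es' , fs') = ∀ {x A} → Node es x → fml A ∈ fs x → Cov es' fs' x A

Cov-mono : ∀ {es es' fs fs' x A} → es ⊆ es' → (es , fs) ≼ (es' , fs') →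
           Cov es fs x A → Cov es' fs' x A
Cov-mono i h (occurs n m)  = h n m
Cov-mono i h (∨-cov c c')  = ∨-cov (Cov-mono i h c) (Cov-mono i h c')
Cov-mono i h (∧-covˡ c)    = ∧-covˡ (Cov-mono i h c)
Cov-mono i h (∧-covʳ c)    = ∧-covʳ (Cov-mono i h c)
Cov-mono i h (□-cov m c)   = □-cov (i m) (Cov-mono i h c)

-- A homomorphism f from labels to nodes. It is total because `five-step` may name a label absent
-- from T, and not necessarily injective because an eigenlabel may be sent to a child that already
-- exists.
record Covers (T : State) (es : Tree) (fs : ℕ → Seq) (f : ℕ → ℕ) : Set where
  field
    node    : ∀ x → Node es (f x)
    formula : ∀ {x A} → x ∶ A ∈ T → Cov es fs (f x) A
    edges   : ∀ {x y} → edge x y ∈ T → (f x , f y) ∈ es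

open Covers

Covers-mono : ∀ {T es es' fs fs' f} → es ⊆ es' → (∀ {v} → Node es v → Node es' v) →
              (es , fs) ≼ (es' , fs') → Covers T es fs f → Covers T es' fs' f
Covers-mono i j h c = record
  { node = λ x → j (node c x) ; formula = λ m → Cov-mono i h (formula c m) ; edges = λ m → i (edges c m) }

Covers-∷ : ∀ {T es fs f x A} → Cov es fs (f x) A → Covers T es fs f → Covers (x ∶ A ∷ T) es fs f
Covers-∷ c cs = record
  { node = node cs
  ; formula = λ { (here refl) → c ; (there m) → formula cs m }
  ; edges = λ { (there m) → edges cs m } }

Covers-fresh : ∀ {T es fs f x y z A} → Fresh z T → z ≢ x → Node es y → (f x , y) ∈ es → Cov es fs y A →
               Covers T es fs f → Covers (z ∶ A ∷ edge x z ∷ T) es fs (set f z y)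
Covers-fresh {T} {es} {fs} {f} {x} {y} {z} fr z≢x n e c cs = record
  { node = nd ; formula = fm ; edges = ed }
  where
  nd : ∀ v → Node es (set f z y v)
  nd v with v ≟ z
  ... | yes _ = n
  ... | no _  = node cs v
  fm : ∀ {v B} → v ∶ B ∈ (z ∶ _ ∷ edge x z ∷ T) → Cov es fs (set f z y v) B
  fm (here refl)       = subst (λ v → Cov es fs v _) (sym (set-≡ f z y)) c
  fm (there (there m)) = subst (λ v → Cov es fs v _) (sym (set-≢ f y (fr m))) (formula cs m)
  ed : ∀ {v w} → edge v w ∈ (z ∶ _ ∷ edge x z ∷ T) → (set f z y v , set f z y w) ∈ es
  ed (there (here refl)) =
    subst₂ (λ v w → (v , w) ∈ es) (sym (set-≢ f y z≢x)) (sym (set-≡ f z y)) e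
  ed (there (there m)) =
    subst₂ (λ v w → (v , w) ∈ es) (sym (set-≢ f y (proj₁ (fr m)))) (sym (set-≢ f y (proj₂ (fr m)))) (edges cs m)

dec-leaf : ∀ es {u z} → Good es → ¬ Node es z → ∀ Σ fs →
           dec ((u , z) ∷ es) (set fs z Σ) ≋ dec es (put u [ bx Σ ] fs)
dec-leaf es {u} {z} g z∉ Σ fs = dec-cong es g
  (put-cong u (cons (bx-cong (≡⇒≋ (set-≡ fs z Σ))) []) (λ w∈ → ≡⇒≋ (set-≢ fs Σ (λ { refl → z∉ w∈ }))))

module Translate (X : AxSet) where
  open Labelled X

  private
    ⊢_ : Seq → Set
    ⊢ Γ = ⊢[ X , false ] Γ

  by-rule : ∀ {es u fs gs Σ} → Good es → Node es u → fs ≋[ es ] put u Σ gs →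
            (∀ C → (∀ {Σ'} → ⊢ dec es (put u Σ' gs) → ⊢ (C ⟨ Σ' ⟩)) → ⊢ (C ⟨ Σ ⟩)) → ⊢ dec es fs
  by-rule {es} {gs = gs} g u∈ p rule with dec-focus es g u∈ gs
  ... | C , eq = exch (≋-sym (trans (dec-cong es g p) (eq _))) (rule C (exch (eq _)))

  replaced : ∀ {es fs gs u F} Σ →
             (∀ {w J} → J ∈ fs w → (w ≡ u × J ≡ fml F) ⊎ J ∈ gs w) →
             (Node es u → Cov es (put u Σ gs) u F) → (es , fs) ≼ (es , put u Σ gs)
  replaced Σ split c n m with split m
  ... | inj₁ (refl , refl) = c n
  ... | inj₂ m'            = occurs n (put-∈ʳ _ Σ _ m')

  -- If the principal formula occurs, the nested rule is applied. If it has been decomposed already,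
  -- the labelled rule is skipped: the parts present cover the active formulas of its premise, for a
  -- conjunction of one of the two.
  translate : ∀ {T es fs f} → Der T → Good es → Covers T es fs f → ⊢ dec es fs
  translate {fs = fs} (axD m n) g c with formula c m | formula c n
  ... | occurs u∈ m' | occurs _ n' with isolate fs m'
  ... | gs , p , split with split n'
  ... | inj₁ (_ , ())
  ... | inj₂ n'' with isolate gs n''
  ... | hs , q , _ =
    by-rule {fs = fs} g u∈
      (λ {w} w∈ → trans (p w) (trans (put-cong _ ≋-refl (λ {w} _ → q w) w∈)
                                     (≡⇒≋ (put-put _ _ _ hs w))))
      (λ C _ → ax C _)
  translate {fs = fs} (∧D m D E) g c with formula c m
  ... | ∧-covˡ a = translate D g (Covers-∷ a c)
  ... | ∧-covʳ a = translate E g (Covers-∷ a c)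
  ... | occurs {A = A ∧' B} u∈ m' with isolate fs m'
  ... | gs , p , split = by-rule {fs = fs} g u∈ (λ {w} _ → p w) (λ C k → ∧r C A B
    (k (translate D g (Covers-∷ (occurs u∈ (put-∈ˡ _ gs (here refl)))
         (Covers-mono id id (replaced [ fml A ] split (λ n → ∧-covˡ (occurs n (put-∈ˡ _ gs (here refl))))) c))))
    (k (translate E g (Covers-∷ (occurs u∈ (put-∈ˡ _ gs (here refl)))
         (Covers-mono id id (replaced [ fml B ] split (λ n → ∧-covʳ (occurs n (put-∈ˡ _ gs (here refl))))) c)))))
  translate {fs = fs} (∨D m D) g c with formula c m
  ... | ∨-cov a a' = translate D g (Covers-∷ a (Covers-∷ a' c))
  ... | occurs {A = A ∨' B} u∈ m' with isolate fs m'
  ... | gs , p , split = by-rule {fs = fs} g u∈ (λ {w} _ → p w) (λ C k → ∨r C A B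
    (k (translate D g
      (Covers-∷ (occurs u∈ A∈) (Covers-∷ (occurs u∈ B∈)
        (Covers-mono id id (replaced (fml A ∷ fml B ∷ []) split (λ n → ∨-cov (occurs n A∈) (occurs n B∈))) c))))))
    where
    A∈ = put-∈ˡ _ gs (here refl)
    B∈ = put-∈ˡ _ gs (there (here refl))
  translate {es = es} {fs} (□D m fr D) g c with formula c m
  ... | □-cov e a = translate D g (Covers-fresh fr (fr m) (edge-target g e) e a c)
  ... | occurs {A = □ A} u∈ m' with isolate fs m'
  ... | gs , p , split = by-rule {fs = fs} g u∈ (λ {w} _ → p w) (λ C k → □r C A
    (k (exch (dec-leaf es g z∉ [ fml A ] gs) (translate D (z∉ , u∈ , g)
      (Covers-fresh fr (fr m) (inj₁ refl) (here refl) A-cov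
        (Covers-mono there inj₂ grow c))))))
    where
    z∉ = treeBound∉ es
    A-cov : Cov ((_ , treeBound es) ∷ es) (set gs (treeBound es) [ fml A ]) (treeBound es) A
    A-cov = occurs (inj₁ refl) (set-∈ˡ gs (treeBound es) (here refl))
    grow : (es , fs) ≼ ((_ , treeBound es) ∷ es , set gs (treeBound es) [ fml A ])
    grow n m with split m
    ... | inj₁ (refl , refl) = □-cov (here refl) A-cov
    ... | inj₂ m'            =
      occurs (inj₂ n) (set-∈ʳ gs (λ { refl → z∉ n }) m')
  translate {es = es} {fs} (dD dX m fr D) g c with formula c m
  ... | occurs {x = u} {A = ◇ A} u∈ m' with isolate fs m'
  ... | gs , p , split = by-rule {fs = fs} g u∈ (λ {w} _ → p w) (λ C k → ◇d dX C A
    (k (exch (trans (dec-leaf es g z∉ [ fml A ] (put u [ fml (◇ A) ] gs)) swapped) (translate D (z∉ , u∈ , g)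
      (Covers-fresh fr (fr m) (inj₁ refl) (here refl) A-cov
        (Covers-mono there inj₂ grow c))))))
    where
    z∉ = treeBound∉ es
    hs = put u [ fml (◇ A) ] gs
    swapped : dec es (put u [ bx [ fml A ] ] hs) ≋ dec es (put u (fml (◇ A) ∷ bx [ fml A ] ∷ []) gs)
    swapped = dec-cong es g (λ {w} w∈ →
      trans (≡⇒≋ (put-put u _ _ gs w)) (put-cong u swap (λ _ → ≋-refl) w∈))
    A-cov : Cov ((u , treeBound es) ∷ es) (set hs (treeBound es) [ fml A ]) (treeBound es) A
    A-cov = occurs (inj₁ refl) (set-∈ˡ hs (treeBound es) (here refl))
    grow : (es , fs) ≼ ((u , treeBound es) ∷ es , set hs (treeBound es) [ fml A ])
    grow n m = occurs (inj₂ n) (set-∈ʳ hs (λ { refl → z∉ n }) (in-hs (split m)))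
      where
      in-hs : ∀ {w J} → (w ≡ u × J ≡ fml (◇ A)) ⊎ J ∈ gs w → J ∈ hs w
      in-hs (inj₁ (refl , refl)) = put-∈ˡ u gs (here refl)
      in-hs (inj₂ m')            = put-∈ʳ u _ gs m'
  translate {T} {es} {fs} {f} (◇D {x} m st D) g c with formula c m
  -- `Cov` has no case for `◇`, since every nested `◇`-rule keeps its principal formula.
  ... | occurs {A = ◇ A} u∈ m' with isolate fs m'
  ... | gs , p , split = step st D
    where
    u = f x
    ◇u : Seq
    ◇u = [ fml (◇ A) ]
    kept : ∀ v Σ → (es , fs) ≼ (es , put u ◇u (put v Σ gs))
    kept v Σ n m with split m
    ... | inj₁ (refl , refl) = occurs n (put-∈ˡ u _ (here refl))
    ... | inj₂ m''           = occurs n (put-∈ʳ u _ _ (put-∈ʳ v _ gs m''))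
    added : ∀ {F} y → Covers (y ∶ F ∷ T) es (put u ◇u (put (f y) [ fml F ] gs)) f
    added y = Covers-∷ (occurs (node c y) (put-∈ʳ u _ _ (put-∈ˡ (f y) gs (here refl))))
                       (Covers-mono id id (kept (f y) _) c)
    nothing-added : ∀ v → dec es (put u ◇u (put v [] gs)) ≋ dec es fs
    nothing-added v = dec-cong es g (λ {w} w∈ →
      ≋-sym (trans (p w) (put-cong u ≋-refl (λ {w} _ → ≡⇒≋ (sym (put-[] v gs w))) w∈)))
    step : ∀ {e} → Step T x A e → Der (e ∷ T) → ⊢ dec es fs
    step (k-step {y} n) D =
      let C , Θ , eq = dec-focus-edge es g (edges c n) gs in
      exch (trans (≋-sym (eq ◇u [])) (nothing-added (f y)))
        (◇k C A Θ (exch (eq ◇u [ fml A ]) (translate D g (added y))))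
    step (t-step tX) D =
      by-rule {fs = fs} g u∈ (λ {w} _ → p w) (λ C k → ◇t tX C A (k (exch
        (dec-cong es g (λ {w} _ → ≡⇒≋ (put-put u _ _ gs w))) (translate D g (added _)))))
    step (b-step {y} bX n) D =
      let C , Θ , eq = dec-focus-edge es g (edges c n) gs
          comm = λ Σ → dec-cong es g (λ {w} _ → put-comm u ◇u (f y) Σ gs w) in
      exch (trans (≋-sym (trans (comm []) (eq [] ◇u))) (nothing-added (f y)))
        (◇b bX C A Θ (exch (trans (comm [ fml A ]) (trans (eq [ fml A ] ◇u) (⟨⟩-cong C swap)))
                           (translate D g (added y))))
    step (four-step {y} 4X n) D =
      let C , Θ , eq = dec-focus-edge es g (edges c n) gs in
      exch (trans (≋-sym (eq ◇u [])) (nothing-added (f y)))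
        (◇4 4X C A Θ (exch (eq ◇u ◇u) (translate D g (added y))))
    step (five-step y 5X n) D =
      -- The edge into x shows that its image is not the root, whence the positive depth.
      let E , q , eq = dec-focus₂ es g u∈ (node c y) gs (hole []) (hole []) (inj₁ (edge-target-≢0 g (edges c n))) in
      exch (trans (≋-sym (eq ◇u [])) (nothing-added (f y)))
        (◇5 5X E A q (exch (eq ◇u ◇u) (translate D g (added y))))

-- Reading a sequent into a state, and the conclusion

Clean : Tree → (ℕ → Seq) → Set
Clean es fs = ∀ {w} → ¬ Node es w → fs w ≡ []

Clean-put : ∀ {es fs u} Σ → Node es u → Clean es fs → Clean es (put u Σ fs)
Clean-put {fs = fs} {u} Σ u∈ cl w∉ = ≡.trans (put-≢ u Σ fs (λ { refl → w∉ u∈ })) (cl w∉)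

record Lists (T : State) (es : Tree) (fs : ℕ → Seq) : Set where
  field
    clean    : Clean es fs
    formulas : ∀ {x A} → x ∶ A ∈ T → Node es x × fml A ∈ fs x
    edges    : ∀ {x y} → edge x y ∈ T → (x , y) ∈ es

module _ (X : AxSet)
         (b,4⇒5 : b ∈X X → four ∈X X → five ∈X X)
         (b,5⇒4 : b ∈X X → five ∈X X → four ∈X X)
         (t,5⇒4 : t ∈X X → five ∈X X → four ∈X X) where
  open Labelled X
  open Frame b,4⇒5 b,5⇒4 t,5⇒4
  open Translate X

  -- Here fs is the content already listed in T, and g is pending content. Tree and state are
  -- complete only at the end of the traversal, so refutations are handed to a continuation that
  -- accepts any later tree and state. On entering a box, the rest of Γ is parked in g.
  unpack : ∀ Γ {x T es fs} g → Good es → Node es x → Clean es g → Lists T es fs →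
           (∀ {T' es' fs'} → T ⊆ T' → (∀ {v} → Node es v → Node es' v) → Good es' →
             Lists T' es' fs' → Sat T' x Γ → ⊢[ X , false ] dec es' (fs' ⊕ g)) →
           ⊢[ X , false ] dec es (put x Γ (fs ⊕ g))
  unpack [] {x} {es = es} g good x∈ cl L K =
    exch (dec-cong es good (λ {w} _ → ≡⇒≋ (sym (put-[] x _ w)))) (K id id good L tt)
  unpack (fml A ∷ Γ) {x} {T} {es} {fs} g good x∈ cl L K =
    exch (dec-cong es good (λ {w} w∈ →
           trans (put-cong x ≋-refl (λ {w} _ → ≡⇒≋ (put-⊕ˡ x [ fml A ] fs g w)) w∈)
           (trans (put-comm x Γ x [ fml A ] _ w) (≡⇒≋ (put-put x [ fml A ] Γ _ w)))))
         (unpack Γ g good x∈ cl L'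
           (λ s j good' M sat → K (s ∘ there) j good' M (refute A (s (here refl)) , sat)))
    where
    L' : Lists (x ∶ A ∷ T) es (put x [ fml A ] fs)
    L' = record
      { clean    = Clean-put [ fml A ] x∈ (Lists.clean L)
      ; formulas = λ { (here refl) → x∈ , put-∈ˡ x fs (here refl)
                     ; (there m) → proj₁ (Lists.formulas L m) , put-∈ʳ x _ fs (proj₂ (Lists.formulas L m)) }
      ; edges    = λ { (there m) → Lists.edges L m } }
  unpack (bx Δ ∷ Γ) {x} {T} {es} {fs} g good x∈ cl L K =
    exch (dec-cong es good packed)
      (unpack Δ {z} {edge x z ∷ T} {(x , z) ∷ es} (put x Γ g) (z∉ , x∈ , good) (inj₁ refl)
        (Clean-put {(x , z) ∷ es} Γ (inj₂ x∈) (λ w∉ → cl (w∉ ∘ inj₂))) L'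
        (λ {T'} {es'} {fs'} s j good' M satΔ →
          exch (dec-cong es' good' (λ {w} _ → ≋-sym (put-⊕ʳ x Γ fs' g w)))
            (unpack Γ g good' (j (inj₂ x∈)) (λ w∉ → cl (w∉ ∘ j ∘ inj₂)) M
              (λ s' j' good'' M' satΓ → K (s' ∘ s ∘ there) (j' ∘ j ∘ inj₂) good'' M'
                ((z , edge⇒Acc (s' (s (here refl))) , Sat-mono s' Δ satΔ) , satΓ)))))
    where
    z = treeBound es
    z∉ = treeBound∉ es
    h = fs ⊕ put x Γ g
    L' : Lists (edge x z ∷ T) ((x , z) ∷ es) fs
    L' = record
      { clean    = λ w∉ → Lists.clean L (w∉ ∘ inj₂)
      ; formulas = λ { (there m) → inj₂ (proj₁ (Lists.formulas L m)) , proj₂ (Lists.formulas L m) }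
      ; edges    = λ { (here refl) → here refl ; (there m) → there (Lists.edges L m) } }
    -- As z is not yet a node, cleanness leaves nothing there, and the box closes over exactly Δ.
    content : put z Δ h z ≡ Δ
    content rewrite put-≡ z Δ h | Lists.clean L z∉ | Clean-put {es} {g} {x} Γ x∈ cl z∉ = ++-identityʳ Δ
    packed : put x [ bx (put z Δ h z) ] (put z Δ h) ≋[ es ] put x (bx Δ ∷ Γ) (fs ⊕ g)
    packed {w} w∈ =
      trans (put-cong x (cons (bx-cong (≡⇒≋ content)) [])
              (λ {w} w∈ → trans (put-leaf Δ h z∉ w∈) (put-⊕ʳ x Γ fs g w)) w∈)
            (≡⇒≋ (put-put x [ bx Δ ] Γ _ w))

  -- The identity on nodes; the root is an arbitrary value elsewhere, for the sake of totality.
  clamp : Tree → ℕ → ℕ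
  clamp es v with Node? es v
  ... | yes _ = v
  ... | no _  = 0

  clamp-node : ∀ es v → Node es (clamp es v)
  clamp-node es v with Node? es v
  ... | yes v∈ = v∈
  ... | no _   = Node-root es

  clamp-id : ∀ {es v} → Node es v → clamp es v ≡ v
  clamp-id {es} {v} v∈ with Node? es v
  ... | yes _  = refl
  ... | no v∉ = contradiction v∈ v∉

  Lists⇒Covers : ∀ {T es fs} → Good es → Lists T es fs → Covers T es fs (clamp es)
  Lists⇒Covers {es = es} {fs} good L = record
    { node    = clamp-node es
    ; formula = λ m → let x∈ , m' = Lists.formulas L m in
        subst (λ v → Cov es fs v _) (sym (clamp-id x∈)) (occurs x∈ m')
    ; edges   = λ m → let e = Lists.edges L m in
        subst₂ (λ v w → (v , w) ∈ es) (sym (clamp-id (edge-source good e)))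
                                      (sym (clamp-id (edge-target good e))) e }

  cut-free : ∀ {c Γ} → ⊢[ X , c ] Γ → ⊢[ X , false ] Γ
  cut-free {Γ = Γ} D =
    exch (≡⇒≋ (≡.trans (put-≡ 0 Γ _) (++-identityʳ Γ)))
      (unpack Γ {0} {[]} {[]} {λ _ → []} (λ _ → []) tt refl (λ _ → refl)
        (record { clean = λ _ → refl ; formulas = λ () ; edges = λ () })
        (λ {T'} {es'} {fs'} _ _ good L sat →
          exch (dec-cong es' good (λ {w} _ → ≡⇒≋ (sym (++-identityʳ (fs' w)))))
            (translate (sound D sat) good (Lists⇒Covers good L))))

theorem2p35 : (X : AxSet) → 45-closed X → (Γ : Seq) → ⊢[ X , true ] Γ → ⊢[ X , false ] Γ
theorem2p35 X (4-closed , 5-closed) Γ = cut-free X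
  (λ bX 4X → 5-closed (λ W R sat w v u Rwv Rwu → sat four 4X v w u (sat b bX w v Rwv) Rwu))
  (λ bX 5X → 4-closed (λ W R sat w v u Rwv Rvu → sat five 5X v w u (sat b bX w v Rwv) Rvu))
  -- Euclideanness at w with w R w turns w R v into v R w, after which the argument is that for b.
  (λ tX 5X → 4-closed (λ W R sat w v u Rwv Rvu →
    sat five 5X v w u (sat five 5X w v w Rwv (sat t tX w)) Rvu))
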